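{- Let $n\in\mathbb{N}$ be even. Then every regular $K_4$-free graph $G$ on $n$ vertices can be made bipartite by removing at most $n^2/9$ edges in such a way that each part has size exactly $n/2$; that is, there is a partition $V(G)=A\cup B$ with $|A|=|B|=n/2$ such that the total number of edges of $G$ lying inside $A$ or inside $B$ is at most $n^2/9$.
   Context: All graphs are finite and simple. A graph is $K_4$-free if it does not contain $K_4$ as a subgraph. -}

module Defs where

open import Data.Fin.Base using (Fin)
open import Data.Fin.Properties using (_≟_; _<?_)
open import Data.Fin.Subset using (Subset; _∪_; _∩_; ⊤; ⊥)
open import Data.Fin.Subset.Properties using (_∈?_)
open import Data.List.Base using (List; length; filter; allFin; cartesianProduct)
open import Data.Nat.Base using (ℕ)
open import Data.Product.Base using (∃-syntax; _×_; _,_)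
open import Function.Definitions using (Injective)
open import Level using (0ℓ)
open import Relation.Binary.Core using (Rel)
open import Relation.Binary.Definitions using (Decidable; Irreflexive; Symmetric)
open import Relation.Binary.PropositionalEquality using (_≡_; _≢_; ≢-sym)
open import Relation.Nullary using (¬_; ¬?; _×-dec_)

-- Finite simple graphs with vertex set Fin n.  Decidability of adjacency
-- is what allows degrees and edges to be counted.
record Graph (n : ℕ) : Set₁ where
  infix 4 _~_ _~?_
  field
    _~_    : Rel (Fin n) 0ℓ
    _~?_   : Decidable _~_
    sym    : Symmetric _~_
    irrefl : Irreflexive _≡_ _~_

  degree : Fin n → ℕ
  degree v = length (filter (v ~?_) (allFin n))

  -- Each edge {i , j} is listed once, as the pair (i , j) with i < j.
  edges : List (Fin n × Fin n)
  edges = filter (λ (i , j) → (i <? j) ×-dec (i ~? j))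
                 (cartesianProduct (allFin n) (allFin n))

  edgesInside : Subset n → List (Fin n × Fin n)
  edgesInside S = filter (λ (i , j) → (i ∈? S) ×-dec (j ∈? S)) edges

  Regular : Set
  Regular = ∃[ d ] (∀ v → degree v ≡ d)

K : (m : ℕ) → Graph m
K m = record
  { _~_    = _≢_
  ; _~?_   = λ i j → ¬? (i ≟ j)
  ; sym    = ≢-sym
  ; irrefl = λ i≡j i≢j → i≢j i≡j
  }

-- H is isomorphic to a (not necessarily induced) subgraph of G.
_IsSubgraphOf_ : ∀ {m n} → Graph m → Graph n → Set
_IsSubgraphOf_ {m} {n} H G =
  ∃[ f ] (Injective {A = Fin m} {B = Fin n} _≡_ _≡_ f
         × (∀ {i j} → Graph._~_ H i j → Graph._~_ G (f i) (f j)))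

K₄-Free : ∀ {n} → Graph n → Set
K₄-Free G = ¬ (K 4 IsSubgraphOf G)

Partition : ∀ {n} → Subset n → Subset n → Set
Partition A B = A ∪ B ≡ ⊤ × A ∩ B ≡ ⊥

{-# OPTIONS --safe #-}
module Submission where

open import Defs
open import Data.Empty using (⊥; ⊥-elim)
open import Data.Fin.Base using (Fin; zero; suc; toℕ; fromℕ<)
open import Data.Fin.Patterns using (0F; 1F; 2F; 3F)
open import Data.Fin.Properties as Fin using (any?; _<?_; toℕ<n; toℕ-fromℕ<; toℕ-injective)
open import Data.Fin.Subset using (Subset; ∣_∣; ∁; _∈_; inside; outside)
open import Data.Fin.Subset.Properties
  using (_∈?_; drop-there; ∩-inverseʳ; p∪∁p≡⊤; ∣∁p∣≡n∸∣p∣; x∈∁p⇒x∉p; x∉p⇒x∈∁p)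
open import Data.Integer.Base as ℤ hiding (suc; ∣_∣; _/_)
open import Data.Integer.Properties hiding (_<?_)
open import Data.Integer.Tactic.RingSolver using (solve-∀)
open import Data.List.Base as List using (List; []; _∷_; _++_; length; filter; allFin; cartesianProduct)
open import Data.Nat.Base as ℕ using (ℕ)
open import Data.Nat.DivMod using (_/_; m*n/n≡m)
open import Data.Nat.Divisibility using (_∣_; divides)
import Data.Nat.Properties as ℕ
open import Data.Product.Base using (Σ-syntax; ∃; _×_; _,_; proj₁; proj₂)
open import Data.Sum.Base using (_⊎_; inj₁; inj₂; [_,_]′)
open import Data.Vec.Base using ([]; _∷_; tabulate; there)
open import Data.Vec.Properties using (lookup∘tabulate; lookup⇒[]=; []=⇒lookup)
open import Function.Base using (_∘_; id)
open import Relation.Binary.Definitions using (tri<; tri≈; tri>)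
open import Relation.Binary.PropositionalEquality
open import Relation.Nullary using (Dec; does; yes; no; contradiction; _×-dec_; ¬_)
open import Relation.Nullary.Decidable using (decidable-stable; toSum)
open import Relation.Unary using (Pred; Decidable)

import Algebra.Properties.Semiring.Sum +-*-semiring as Sum

-- By regularity a set of n/2 vertices and its complement span equally many edges, so it
-- suffices to find n/2 vertices spanning at most n²/18 edges.  Write ⟨f , g⟩ = Σ M i j f i g j
-- for the adjacency matrix M.  Sets may be replaced by weights f : V → [0 , 1] of total n/2:
-- ⟨f , f⟩ is concave along every transfer of weight between two vertices, so f can be
-- rounded to a set without increasing it.
--
-- If 2d ≤ n, try for every vertex u the weight that is constant on V ∖ N(u) and zero on N(u).
-- If 2d > n, try for every edge uw the weight that is 1 on N(u) ∖ N(w) and a smaller constant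
-- on N(u) ∩ N(w), which is independent as G is K₄-free.  If every attempt fails, then
-- x u = ⟨1_N(u) , 1_N(u)⟩ is large for every u.
--
-- For a triangle uvw the three pairwise common neighbourhoods are disjoint and independent,
-- and Turán's theorem bounds the edges outside them.  Summed over all triangles this gives
-- Σ bracket u ≤ 0, where bracket u combines moments of the codegrees of u with its neighbours.
-- But Laplacian estimates for these moments show bracket u > 0 as soon as x u is large.

-- For 6 | n the balanced complete tripartite graph, with d = 2n/3, attains n²/9, so the estimates
-- used when 2d > n have to be equalities there; strictness comes only from the failed attempts. The
-- case split is forced by the weights: bounded by 1 and of total n/2, they need a support of at
-- least n/2 vertices. The complement of N(u) is that large exactly when 2d ≤ n; otherwise N(u) is,
-- and there an independent common neighbourhood can carry the reduced weight. The obstacle in the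
-- triangle count is the number of edges between two of the common neighbourhoods of a triangle,
-- which codegrees do not determine. Turán's theorem bounds it from above. A lower bound comes from
-- the part of N(u) outside N(v) and N(w), which spans a nonnegative number of edges. In the right
-- combination this quantity cancels, and what is left, summed over all triangles, depends only on
-- moments at single vertices.

private variable
  n : ℕ

-- Integer inequalities

0≤-resp : ∀ {i j} → i ≡ j → 0ℤ ≤ i → 0ℤ ≤ j
0≤-resp = subst (0ℤ ≤_)

0≤+ : ∀ {i j} → 0ℤ ≤ i → 0ℤ ≤ j → 0ℤ ≤ i + j
0≤+ = +-mono-≤

0≤* : ∀ {i j} → 0ℤ ≤ i → 0ℤ ≤ j → 0ℤ ≤ i * j
0≤* {i} {j} 0≤i 0≤j = subst (_≤ i * j) (*-zeroʳ i) (*-monoˡ-≤-nonNeg i {{nonNegative 0≤i}} 0≤j)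

0<* : ∀ {i j} → 0ℤ < i → 0ℤ < j → 0ℤ < i * j
0<* {i} {j} 0<i 0<j = subst (_< i * j) (*-zeroʳ i) (*-monoˡ-<-pos i {{positive 0<i}} 0<j)

0≤sq : ∀ i → 0ℤ ≤ i * i
0≤sq (+ m)    = 0≤* {+ m} {+ m} (+≤+ ℕ.z≤n) (+≤+ ℕ.z≤n)
0≤sq -[1+ m ] = +≤+ ℕ.z≤n

0≤-cancel : ∀ k {i} → 0ℤ < k → 0ℤ ≤ k * i → 0ℤ ≤ i
0≤-cancel k {i} 0<k 0≤ki = *-cancelˡ-≤-pos 0ℤ i k {{positive 0<k}} (subst (_≤ k * i) (sym (*-zeroʳ k)) 0≤ki)

0<-cancel : ∀ k {i} → 0ℤ ≤ k → 0ℤ < k * i → 0ℤ < i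
0<-cancel k {i} 0≤k 0<ki = *-cancelˡ-<-nonNeg k {{nonNegative 0≤k}} (subst (_< k * i) (sym (*-zeroʳ k)) 0<ki)

0<-⇒< : ∀ {i j} → 0ℤ < j - i → i < j
0<-⇒< {i} {j} p = subst₂ _<_ (+-identityʳ i) (lemma i j) (+-monoʳ-< i p)
  where lemma : ∀ i j → i + (j - i) ≡ j
        lemma = solve-∀

<⇒0<- : ∀ {i j} → i < j → 0ℤ < j - i
<⇒0<- {i} {j} p = subst (_< j - i) (+-inverseʳ i) (+-monoˡ-< (- i) p)

-- Opaque, so that unification can read off the summand from a sum of unknown length.
opaque

  sum : (Fin n → ℤ) → ℤ
  sum = Sum.sum

  sum-empty : (f : Fin 0 → ℤ) → sum f ≡ 0ℤ
  sum-empty f = refl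

  sum-suc : (f : Fin (ℕ.suc n) → ℤ) → sum f ≡ f zero + sum (f ∘ suc)
  sum-suc f = refl

  sum-cong : {f g : Fin n → ℤ} → (∀ i → f i ≡ g i) → sum f ≡ sum g
  sum-cong = Sum.sum-cong-≗

  sum-* : ∀ k (f : Fin n → ℤ) → sum (λ i → k * f i) ≡ k * sum f
  sum-* k f = sym (Sum.*-distribˡ-sum k f)

  sum-+ : (f g : Fin n → ℤ) → sum (λ i → f i + g i) ≡ sum f + sum g
  sum-+ = Sum.∑-distrib-+

  sum-swap : ∀ {m} (f : Fin m → Fin n → ℤ) → sum (λ i → sum (f i)) ≡ sum (λ j → sum (λ i → f i j))
  sum-swap = Sum.∑-comm

  sum-const : ∀ n k → sum {n} (λ _ → k) ≡ + n * k
  sum-const ℕ.zero    k = sym (*-zeroˡ k)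
  sum-const (ℕ.suc n) k = trans (cong (λ s → k + s) (sum-const n k)) (sym (suc-* (+ n) k))

  sum-nonneg : (f : Fin n → ℤ) → (∀ i → 0ℤ ≤ f i) → 0ℤ ≤ sum f
  sum-nonneg {ℕ.zero}  f 0≤f = ≤-refl
  sum-nonneg {ℕ.suc n} f 0≤f = 0≤+ (0≤f zero) (sum-nonneg (f ∘ suc) (0≤f ∘ suc))

  sum-pos : Fin n → (f : Fin n → ℤ) → (∀ i → 0ℤ < f i) → 0ℤ < sum f
  sum-pos {ℕ.suc n} _ f 0<f = +-mono-<-≤ (0<f zero) (sum-nonneg (f ∘ suc) (<⇒≤ ∘ 0<f ∘ suc))

sum-zero : (f : Fin n → ℤ) → (∀ i → f i ≡ 0ℤ) → sum f ≡ 0ℤ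
sum-zero {n} f f≡0 = trans (sum-cong f≡0) (trans (sum-const n 0ℤ) (*-zeroʳ (+ n)))

sum-lin₂ : ∀ a b (f g : Fin n → ℤ) → sum (λ i → a * f i + b * g i) ≡ a * sum f + b * sum g
sum-lin₂ a b f g = trans (sum-+ _ _) (cong₂ _+_ (sum-* a f) (sum-* b g))

sum-lin₃ : ∀ a b c (f g h : Fin n → ℤ) →
           sum (λ i → a * f i + b * g i + c * h i) ≡ a * sum f + b * sum g + c * sum h
sum-lin₃ a b c f g h = trans (sum-+ _ _) (cong₂ _+_ (sum-lin₂ a b f g) (sum-* c h))

-- Bilinear forms of a matrix

row : (Fin n → Fin n → ℤ) → Fin n → (Fin n → ℤ) → ℤ
row M i f = sum λ j → M i j * f j

row-lin : (M : Fin n → Fin n → ℤ) → ∀ i a b f g → row M i (λ j → a * f j + b * g j) ≡ a * row M i f + b * row M i g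
row-lin M i a b f g = trans (sum-cong λ j → lemma a b (M i j) (f j) (g j)) (sum-lin₂ a b _ _)
  where lemma : ∀ a b x y z → x * (a * y + b * z) ≡ a * (x * y) + b * (x * z)
        lemma = solve-∀

form : (Fin n → Fin n → ℤ) → (Fin n → ℤ) → (Fin n → ℤ) → ℤ
form M f g = sum λ i → f i * row M i g

module _ (M : Fin n → Fin n → ℤ) where

  form-cong : ∀ {f f′ g g′} → (∀ i → f i ≡ f′ i) → (∀ i → g i ≡ g′ i) → form M f g ≡ form M f′ g′
  form-cong f≗ g≗ = sum-cong λ i → cong₂ _*_ (f≗ i) (sum-cong λ j → cong (M i j *_) (g≗ j))

  form-pairs : ∀ f g → form M f g ≡ sum λ i → sum λ j → M i j * (f i * g j)
  form-pairs f g = sum-cong λ i → trans (sym (sum-* (f i) _)) (sum-cong λ j → assoc (f i) (M i j) (g j))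
    where assoc : ∀ a b c → a * (b * c) ≡ b * (a * c)
          assoc = solve-∀

  form-linˡ : ∀ a b f g h → form M (λ i → a * f i + b * g i) h ≡ a * form M f h + b * form M g h
  form-linˡ a b f g h = trans (sum-cong λ i → distrib a b (f i) (g i) (sum λ j → M i j * h j)) (sum-lin₂ a b _ _)
    where distrib : ∀ a b x y z → (a * x + b * y) * z ≡ a * (x * z) + b * (y * z)
          distrib = solve-∀

  form-linʳ : ∀ a b f g h → form M f (λ i → a * g i + b * h i) ≡ a * form M f g + b * form M f h
  form-linʳ a b f g h = trans
    (sum-cong λ i → trans (cong (f i *_) (row-lin M i a b g h)) (distrib a b (f i) (row M i g) (row M i h)))
    (sum-lin₂ a b _ _)
    where
    distrib : ∀ a b x y z → x * (a * y + b * z) ≡ a * (x * y) + b * (x * z)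
    distrib = solve-∀

  form-nonneg : (∀ i j → 0ℤ ≤ M i j) → ∀ f g → (∀ i → 0ℤ ≤ f i) → (∀ i → 0ℤ ≤ g i) → 0ℤ ≤ form M f g
  form-nonneg 0≤M f g 0≤f 0≤g = sum-nonneg _ λ i → 0≤* (0≤f i) (sum-nonneg _ λ j → 0≤* (0≤M i j) (0≤g j))

  module _ (M-sym : ∀ i j → M i j ≡ M j i) where

    form-sym : ∀ f g → form M f g ≡ form M g f
    form-sym f g = trans (form-pairs f g) (trans (sum-swap _) (trans (sum-cong λ j → sum-cong λ i →
      cong₂ _*_ (M-sym i j) (*-comm (f i) (g j))) (sym (form-pairs g f))))

    form-sq : ∀ a b f g → let q = λ i → a * f i + b * g i in
              form M q q ≡ a * a * form M f f + + 2 * (a * b) * form M f g + b * b * form M g g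
    form-sq a b f g = begin
      form M q q                                                             ≡⟨ form-linˡ a b f g q ⟩
      a * form M f q + b * form M g q                                        ≡⟨ cong₂ (λ x y → a * x + b * y)
        (form-linʳ a b f f g) (form-linʳ a b g f g) ⟩
      a * (a * form M f f + b * form M f g) + b * (a * form M g f + b * form M g g)
        ≡⟨ cong (λ z → a * (a * form M f f + b * form M f g) + b * (a * z + b * form M g g)) (form-sym g f) ⟩
      a * (a * form M f f + b * form M f g) + b * (a * form M f g + b * form M g g)
        ≡⟨ expand a b (form M f f) (form M f g) (form M g g) ⟩
      a * a * form M f f + + 2 * (a * b) * form M f g + b * b * form M g g   ∎
      where
      open ≡-Reasoning
      q = λ i → a * f i + b * g i
      expand : ∀ a b x y z → a * (a * x + b * y) + b * (a * y + b * z) ≡ a * a * x + + 2 * (a * b) * y + b * b * z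
      expand = solve-∀

-- Indicators and point masses

ind : {P : Set} → Dec P → ℤ
ind (yes _) = 1ℤ
ind (no  _) = 0ℤ

-- An indexed family rather than a disjunction of equations: once a matrix entry has been
-- abstracted, matching on its `Bit` replaces it by a literal, and the inequality in question
-- computes.
data Bit : ℤ → Set where
  bit0 : Bit 0ℤ
  bit1 : Bit 1ℤ

ind-bit : {P : Set} (P? : Dec P) → Bit (ind P?)
ind-bit (yes _) = bit1
ind-bit (no _)  = bit0

bit-nonneg : ∀ {b} → Bit b → 0ℤ ≤ b
bit-nonneg bit0 = +≤+ ℕ.z≤n
bit-nonneg bit1 = +≤+ ℕ.z≤n

bit-* : ∀ {a b} → Bit a → Bit b → Bit (a * b)
bit-* bit0 bit0 = bit0
bit-* bit0 bit1 = bit0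
bit-* bit1 bit0 = bit0
bit-* bit1 bit1 = bit1

ind-yes : {P : Set} (P? : Dec P) → P → ind P? ≡ 1ℤ
ind-yes (yes _) p = refl
ind-yes (no ¬p) p = contradiction p ¬p

ind-no : {P : Set} (P? : Dec P) → ¬ P → ind P? ≡ 0ℤ
ind-no (yes p) ¬p = contradiction p ¬p
ind-no (no _)  ¬p = refl

ind-1 : {P : Set} (P? : Dec P) → ind P? ≡ 1ℤ → P
ind-1 (yes p) _ = p
ind-1 (no _) ()

pt : Fin n → Fin n → ℤ
pt i j = ind (i Fin.≟ j)

pt-self : (i : Fin n) → pt i i ≡ 1ℤ
pt-self i = ind-yes (i Fin.≟ i) refl

pt-other : {i j : Fin n} → i ≢ j → pt i j ≡ 0ℤ
pt-other {i = i} {j} = ind-no (i Fin.≟ j)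

pt-suc : (i j : Fin n) → pt (suc i) (suc j) ≡ pt i j
pt-suc i j with i Fin.≟ j
... | yes refl = refl
... | no  _    = refl

sum-pt : (i : Fin n) (f : Fin n → ℤ) → sum (λ j → pt i j * f j) ≡ f i
sum-pt zero    f = begin
  sum (λ j → pt zero j * f j)              ≡⟨ sum-suc _ ⟩
  1ℤ * f zero + sum (λ j → 0ℤ * f (suc j)) ≡⟨ cong₂ _+_ (*-identityˡ (f zero)) (sum-zero _ λ j → *-zeroˡ (f (suc j))) ⟩
  f zero + 0ℤ                              ≡⟨ +-identityʳ (f zero) ⟩
  f zero                                   ∎
  where open ≡-Reasoning
sum-pt (suc i) f = begin
  sum (λ j → pt (suc i) j * f j)                           ≡⟨ sum-suc _ ⟩
  0ℤ * f zero + sum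
    (λ j → pt (suc i) (suc j) * f (suc j)) ≡⟨ cong₂ _+_ (*-zeroˡ (f zero))
    (sum-cong λ j → cong (_* f (suc j)) (pt-suc i j)) ⟩
  0ℤ + sum (λ j → pt i j * f (suc j))                      ≡⟨ +-identityˡ _ ⟩
  sum (λ j → pt i j * f (suc j))                           ≡⟨ sum-pt i (f ∘ suc) ⟩
  f (suc i)                                                ∎
  where open ≡-Reasoning

sum-pt-1 : (i : Fin n) → sum (pt i) ≡ 1ℤ
sum-pt-1 i = trans (sum-cong λ j → sym (*-identityʳ (pt i j))) (sum-pt i (λ _ → 1ℤ))

row-pt : (M : Fin n → Fin n → ℤ) → ∀ i j → row M i (pt j) ≡ M i j
row-pt M i j = trans (sum-cong λ k → *-comm (M i k) (pt j k)) (sum-pt j (M i))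

form-ptˡ : (M : Fin n → Fin n → ℤ) → ∀ i f → form M (pt i) f ≡ row M i f
form-ptˡ M i f = sum-pt i (λ j → row M j f)

-- Turán's theorem for K₄

module Turán {n} (M : Fin n → Fin n → ℤ) (M-bit : ∀ i j → Bit (M i j))
             (M-sym : ∀ i j → M i j ≡ M j i) (M-diag : ∀ i → M i i ≡ 0ℤ)
             (M-free : ∀ i j k l → M i j ≡ 1ℤ → M i k ≡ 1ℤ → M i l ≡ 1ℤ →
                       M j k ≡ 1ℤ → M j l ≡ 1ℤ → M k l ≡ 1ℤ → ⊥) where

  -- The coefficients 1 and -1 are written out so that `sum-lin₂`, `row-lin` and `form-sq` apply by
  -- unification. Later linear combinations have the same shape for the same reason.
  remove : (Fin n → ℤ) → Fin n → Fin n → ℤ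
  remove r u j = 1ℤ * r j + -1ℤ * pt u j

  adjacent⇒≢ : ∀ {u v} → M u v ≡ 1ℤ → u ≢ v
  adjacent⇒≢ {u} Muv refl with trans (sym (M-diag u)) Muv
  ... | ()

  remove-other : ∀ r {u v} → u ≢ v → remove r u v ≡ r v
  remove-other r {u} {v} u≢v = trans (cong (λ z → 1ℤ * r v + -1ℤ * z) (pt-other u≢v)) (lemma (r v))
    where lemma : ∀ x → 1ℤ * x + -1ℤ * 0ℤ ≡ x
          lemma = solve-∀

  remove-bit : ∀ {r u} → (∀ j → Bit (r j)) → r u ≡ 1ℤ → ∀ j → Bit (remove r u j)
  remove-bit {r} {u} r-bit ru j with u Fin.≟ j
  ... | yes refl = subst (λ z → Bit (1ℤ * z + -1ℤ * 1ℤ)) (sym ru) bit0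
  ... | no  _    = subst Bit (lemma (r j)) (r-bit j)
    where lemma : ∀ x → x ≡ 1ℤ * x + -1ℤ * 0ℤ
          lemma = solve-∀

  remove-sum : ∀ r u → sum r ≡ sum (remove r u) + 1ℤ
  remove-sum r u = sym
    (trans (cong (_+ 1ℤ) (trans (sum-lin₂ 1ℤ -1ℤ r (pt u)) (cong (λ z → 1ℤ * sum r + -1ℤ * z) (sum-pt-1 u))))
    (lemma (sum r)))
    where lemma : ∀ x → 1ℤ * x + -1ℤ * 1ℤ + 1ℤ ≡ x
          lemma = solve-∀

  remove-row : ∀ r u v → row M u r ≡ row M u (remove r v) + M u v
  remove-row r u v = sym
    (trans (cong (_+ M u v)
    (trans (row-lin M u 1ℤ -1ℤ r (pt v)) (cong (λ z → 1ℤ * row M u r + -1ℤ * z) (row-pt M u v))))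
    (lemma (row M u r) (M u v)))
    where lemma : ∀ x m → 1ℤ * x + -1ℤ * m + m ≡ x
          lemma = solve-∀

  remove-form : ∀ r u → form M r r ≡ form M (remove r u) (remove r u) + + 2 * row M u (remove r u)
  remove-form r u = begin
    form M r r ≡⟨ lemma (form M r r) (row M u r) ⟩
    (1ℤ * 1ℤ * form M r r + + 2 * (1ℤ * -1ℤ) * row M u r + -1ℤ * -1ℤ * 0ℤ) + + 2 * row M u r
      ≡⟨ cong₂ (λ x y → (1ℤ * 1ℤ * form M r r + + 2 * (1ℤ * -1ℤ) * x + -1ℤ * -1ℤ * y) + + 2 * row M u r)
           (sym (trans (form-sym M M-sym r (pt u)) (form-ptˡ M u r)))
           (sym (trans (form-ptˡ M u (pt u)) (trans (row-pt M u u) (M-diag u)))) ⟩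
    (1ℤ * 1ℤ * form M r r + + 2 * (1ℤ * -1ℤ) * form M r (pt u) + -1ℤ * -1ℤ * form M (pt u) (pt u)) + + 2 * row M u r
      ≡⟨ cong₂ (λ x y → x + + 2 * y) (sym (form-sq M M-sym 1ℤ -1ℤ r (pt u))) row≡ ⟩
    form M (remove r u) (remove r u) + + 2 * row M u (remove r u) ∎
    where
    open ≡-Reasoning
    lemma : ∀ x y → x ≡ (1ℤ * 1ℤ * x + + 2 * (1ℤ * -1ℤ) * y + -1ℤ * -1ℤ * 0ℤ) + + 2 * y
    lemma = solve-∀
    row≡ : row M u r ≡ row M u (remove r u)
    row≡ = trans (remove-row r u u) (trans (cong (λ z → row M u (remove r u) + z) (M-diag u)) (+-identityʳ _))

  Triangle : (Fin n → ℤ) → Fin n → Fin n → Fin n → Set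
  Triangle r u v w = (r u ≡ 1ℤ × r v ≡ 1ℤ × r w ≡ 1ℤ) × (M u v ≡ 1ℤ × M u w ≡ 1ℤ × M v w ≡ 1ℤ)

  triangle? : ∀ r → Dec (∃ λ u → ∃ λ v → ∃ λ w → Triangle r u v w)
  triangle? r = any? λ u → any? λ v → any? λ w →
    ((r u ≟ 1ℤ) ×-dec (r v ≟ 1ℤ) ×-dec (r w ≟ 1ℤ)) ×-dec ((M u v ≟ 1ℤ) ×-dec (M u w ≟ 1ℤ) ×-dec (M v w ≟ 1ℤ))

  Edge : (Fin n → ℤ) → Fin n → Fin n → Set
  Edge r u v = (r u ≡ 1ℤ × r v ≡ 1ℤ) × M u v ≡ 1ℤ

  edge? : ∀ r → Dec (∃ λ u → ∃ λ v → Edge r u v)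
  edge? r = any? λ u → any? λ v → ((r u ≟ 1ℤ) ×-dec (r v ≟ 1ℤ)) ×-dec (M u v ≟ 1ℤ)

  drop-below : ∀ {m} s t c → s ≡ t + + ℕ.suc c → s < + ℕ.suc m → t < + m
  drop-below {m} s t c refl s<1+m = 0<-⇒<
    (subst (0ℤ <_) (lemma t (+ m) (+ c)) (+-mono-<-≤ (<⇒0<- s<1+m) (+≤+ {n = c} ℕ.z≤n)))
    where lemma : ∀ t m c → (1ℤ + m) - (t + (1ℤ + c)) + c ≡ m - t
          lemma = solve-∀

  -- Induction on the size of the set, with `m` as a bound. If the set contains a triangle, every
  -- other vertex is adjacent to at most two of its corners, so deleting it loses few edges. If it
  -- contains only an edge, every other vertex of the set is adjacent to at most one end. Otherwise
  -- the form vanishes. As `form` counts ordered pairs, the claim is the usual bound of a third of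
  -- the squared size.
  turán-below : ∀ m r → (∀ j → Bit (r j)) → sum r < + m → + 3 * form M r r ≤ + 2 * (sum r * sum r)
  turán-below ℕ.zero    r r-bit r<0 = contradiction r<0 (≤⇒≯ (sum-nonneg r (bit-nonneg ∘ r-bit)))
  turán-below (ℕ.suc m) r r-bit r<1+m with triangle? r
  ... | yes (u , v , w , (ru , rv , rw) , (Muv , Muw , Mvw)) = 0≤i-j⇒j≤i
          (0≤-resp (sym total) (0≤+ (i≤j⇒0≤j-i ih) (0≤* {+ 6} (+≤+ ℕ.z≤n) few)))
    where
    r₁ = remove r u
    r₂ = remove r₁ v
    r₃ = remove r₂ w
    r₁v : r₁ v ≡ 1ℤ
    r₁v = trans (remove-other r (adjacent⇒≢ Muv)) rv
    r₂w : r₂ w ≡ 1ℤ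
    r₂w = trans (remove-other r₁ (adjacent⇒≢ Mvw)) (trans (remove-other r (adjacent⇒≢ Muw)) rw)
    bits : ∀ j → Bit (r₃ j)
    bits = remove-bit (remove-bit (remove-bit r-bit ru) r₁v) r₂w
    sum≡ : sum r ≡ sum r₃ + + 3
    sum≡ = trans (remove-sum r u)
      (trans (cong (_+ 1ℤ) (trans (remove-sum r₁ v) (cong (_+ 1ℤ) (remove-sum r₂ w)))) (lemma (sum r₃)))
      where lemma : ∀ k → k + 1ℤ + 1ℤ + 1ℤ ≡ k + + 3
            lemma = solve-∀
    ih : + 3 * form M r₃ r₃ ≤ + 2 * (sum r₃ * sum r₃)
    ih = turán-below m r₃ bits (drop-below (sum r) (sum r₃) 2 sum≡ r<1+m)
    few : 0ℤ ≤ + 2 * sum r₃ - (row M u r₃ + row M v r₃ + row M w r₃)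
    few = 0≤-resp regroup (sum-nonneg _ λ j → 0≤* (deg≤2 j) (bit-nonneg (bits j)))
      where
      deg≤2 : ∀ j → 0ℤ ≤ + 2 - (M u j + M v j + M w j)
      deg≤2 j with M u j in uj | M v j in vj | M w j in wj | M-bit u j | M-bit v j | M-bit w j
      ... | _ | _ | _ | bit0 | bit0 | bit0 = +≤+ ℕ.z≤n
      ... | _ | _ | _ | bit0 | bit0 | bit1 = +≤+ ℕ.z≤n
      ... | _ | _ | _ | bit0 | bit1 | bit0 = +≤+ ℕ.z≤n
      ... | _ | _ | _ | bit0 | bit1 | bit1 = +≤+ ℕ.z≤n
      ... | _ | _ | _ | bit1 | bit0 | bit0 = +≤+ ℕ.z≤n
      ... | _ | _ | _ | bit1 | bit0 | bit1 = +≤+ ℕ.z≤n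
      ... | _ | _ | _ | bit1 | bit1 | bit0 = +≤+ ℕ.z≤n
      ... | _ | _ | _ | bit1 | bit1 | bit1 = ⊥-elim (M-free u v w j Muv Muw uj Mvw vj wj)
      pointwise : ∀ a b c x → (+ 2 - (a + b + c)) * x ≡ + 2 * x + -1ℤ * (1ℤ * (a * x) + 1ℤ * (b * x) + 1ℤ * (c * x))
      pointwise = solve-∀
      lemma : ∀ s a b c → + 2 * s + -1ℤ * (1ℤ * a + 1ℤ * b + 1ℤ * c) ≡ + 2 * s - (a + b + c)
      lemma = solve-∀
      regroup : sum (λ j → (+ 2 - (M u j + M v j + M w j)) * r₃ j) ≡ + 2 * sum r₃ -
        (row M u r₃ + row M v r₃ + row M w r₃)
      regroup = trans (sum-cong λ j → pointwise (M u j) (M v j) (M w j) (r₃ j))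
               (trans (sum-lin₂ (+ 2) -1ℤ _ _)
               (trans (cong (λ z → + 2 * sum r₃ + -1ℤ * z) (sum-lin₃ 1ℤ 1ℤ 1ℤ _ _ _))
               (lemma (sum r₃) (row M u r₃) (row M v r₃) (row M w r₃))))
    form≡ : form M r r ≡ form M r₃ r₃ + + 2 * (row M u r₃ + row M v r₃ + row M w r₃) + + 6
    form≡ = begin
      form M r r ≡⟨ remove-form r u ⟩
      form M r₁ r₁ + + 2 * row M u r₁ ≡⟨ cong₂ (λ x y → x + + 2 * y)
        (trans (remove-form r₁ v)
        (cong₂ (λ x y → x + + 2 * y) (remove-form r₂ w)
        (trans (remove-row r₂ v w) (cong (λ z → row M v r₃ + z) Mvw))))
        (trans (remove-row r₁ u v) (cong₂ _+_ (trans (remove-row r₂ u w) (cong (λ z → row M u r₃ + z) Muw)) Muv)) ⟩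
      form M r₃ r₃ + + 2 * row M w r₃ + + 2 * (row M v r₃ + 1ℤ) + + 2 *
        (row M u r₃ + 1ℤ + 1ℤ) ≡⟨ lemma (form M r₃ r₃) (row M u r₃) (row M v r₃) (row M w r₃) ⟩
      form M r₃ r₃ + + 2 * (row M u r₃ + row M v r₃ + row M w r₃) + + 6 ∎
      where
      open ≡-Reasoning
      lemma : ∀ x a b c → x + + 2 * c + + 2 * (b + 1ℤ) + + 2 * (a + 1ℤ + 1ℤ) ≡ x + + 2 * (a + b + c) + + 6
      lemma = solve-∀
    total : + 2 * (sum r * sum r) - + 3 * form M r r ≡ (+ 2 * (sum r₃ * sum r₃) - + 3 * form M r₃ r₃) + + 6 *
      (+ 2 * sum r₃ - (row M u r₃ + row M v r₃ + row M w r₃))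
    total = trans (cong₂ (λ s e → + 2 * (s * s) - + 3 * e) sum≡ form≡)
      (lemma (sum r₃) (form M r₃ r₃) (row M u r₃ + row M v r₃ + row M w r₃))
      where lemma : ∀ k e a → + 2 * ((k + + 3) * (k + + 3)) - + 3 * (e + + 2 * a + + 6) ≡
              (+ 2 * (k * k) - + 3 * e) + + 6 * (+ 2 * k - a)
            lemma = solve-∀
  ... | no no-triangle with edge? r
  ...   | yes (u , v , (ru , rv) , Muv) = 0≤i-j⇒j≤i
          (0≤-resp (sym total)
          (0≤+ (0≤+ (i≤j⇒0≤j-i ih) (0≤* {+ 6} (+≤+ ℕ.z≤n) few))
          (0≤+ (0≤* {+ 2} (+≤+ ℕ.z≤n) (sum-nonneg r₂ (bit-nonneg ∘ bits))) (+≤+ {n = 2} ℕ.z≤n))))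
    where
    r₁ = remove r u
    r₂ = remove r₁ v
    bits : ∀ j → Bit (r₂ j)
    bits = remove-bit (remove-bit r-bit ru) (trans (remove-other r (adjacent⇒≢ Muv)) rv)
    sum≡ : sum r ≡ sum r₂ + + 2
    sum≡ = trans (remove-sum r u) (trans (cong (_+ 1ℤ) (remove-sum r₁ v)) (lemma (sum r₂)))
      where lemma : ∀ k → k + 1ℤ + 1ℤ ≡ k + + 2
            lemma = solve-∀
    ih : + 3 * form M r₂ r₂ ≤ + 2 * (sum r₂ * sum r₂)
    ih = turán-below m r₂ bits (drop-below (sum r) (sum r₂) 1 sum≡ r<1+m)
    few : 0ℤ ≤ sum r₂ - (row M u r₂ + row M v r₂)
    few = 0≤-resp regroup (sum-nonneg _ deg≤1)
      where
      -- `K₄` is excluded everywhere, but triangles only inside `r`. Hence the factor `r₂ j` is part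
      -- of the inequality here, unlike in the triangle case.
      deg≤1 : ∀ j → 0ℤ ≤ (1ℤ - (M u j + M v j)) * r₂ j
      deg≤1 j with M u j in uj | M v j in vj | r₂ j in r₂j | M-bit u j | M-bit v j | bits j
      ... | _ | _ | _ | bit0 | bit0 | bit0 = +≤+ ℕ.z≤n
      ... | _ | _ | _ | bit0 | bit0 | bit1 = +≤+ ℕ.z≤n
      ... | _ | _ | _ | bit0 | bit1 | bit0 = +≤+ ℕ.z≤n
      ... | _ | _ | _ | bit0 | bit1 | bit1 = +≤+ ℕ.z≤n
      ... | _ | _ | _ | bit1 | bit0 | bit0 = +≤+ ℕ.z≤n
      ... | _ | _ | _ | bit1 | bit0 | bit1 = +≤+ ℕ.z≤n
      ... | _ | _ | _ | bit1 | bit1 | bit0 = +≤+ ℕ.z≤n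
      ... | _ | _ | _ | bit1 | bit1 | bit1 = ⊥-elim (no-triangle (u , v , j , (ru , rv , rj) , (Muv , uj , vj)))
        where rj : r j ≡ 1ℤ
              rj = trans (sym (trans (remove-other r₁ (adjacent⇒≢ vj)) (remove-other r (adjacent⇒≢ uj)))) r₂j
      pointwise : ∀ a b x → (1ℤ - (a + b)) * x ≡ 1ℤ * x + -1ℤ * (a * x) + -1ℤ * (b * x)
      pointwise = solve-∀
      lemma : ∀ s a b → 1ℤ * s + -1ℤ * a + -1ℤ * b ≡ s - (a + b)
      lemma = solve-∀
      regroup : sum (λ j → (1ℤ - (M u j + M v j)) * r₂ j) ≡ sum r₂ - (row M u r₂ + row M v r₂)
      regroup = trans (sum-cong λ j → pointwise (M u j) (M v j) (r₂ j))
               (trans (sum-lin₃ 1ℤ -1ℤ -1ℤ _ _ _) (lemma (sum r₂) (row M u r₂) (row M v r₂)))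
    form≡ : form M r r ≡ form M r₂ r₂ + + 2 * (row M u r₂ + row M v r₂) + + 2
    form≡ = trans (remove-form r u)
      (trans (cong₂ (λ x y → x + + 2 * y) (remove-form r₁ v)
      (trans (remove-row r₁ u v) (cong (λ z → row M u r₂ + z) Muv))) (lemma (form M r₂ r₂) (row M u r₂) (row M v r₂)))
      where
      lemma : ∀ x a b → x + + 2 * b + + 2 * (a + 1ℤ) ≡ x + + 2 * (a + b) + + 2
      lemma = solve-∀
    total : + 2 * (sum r * sum r) - + 3 * form M r r ≡ (+ 2 * (sum r₂ * sum r₂) - + 3 * form M r₂ r₂) + + 6 *
      (sum r₂ - (row M u r₂ + row M v r₂)) + (+ 2 * sum r₂ + + 2)
    total = trans (cong₂ (λ s e → + 2 * (s * s) - + 3 * e) sum≡ form≡)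
      (lemma (sum r₂) (form M r₂ r₂) (row M u r₂ + row M v r₂))
      where lemma : ∀ k e a → + 2 * ((k + + 2) * (k + + 2)) - + 3 * (e + + 2 * a + + 2) ≡
              (+ 2 * (k * k) - + 3 * e) + + 6 * (k - a) + (+ 2 * k + + 2)
            lemma = solve-∀
  ...   | no no-edge = subst (_≤ + 2 * (sum r * sum r)) (sym (cong (λ z → + 3 * z) form≡0))
          (0≤* {+ 2} (+≤+ ℕ.z≤n) (0≤sq (sum r)))
    where
    vanish : ∀ i j → M i j * (r i * r j) ≡ 0ℤ
    vanish i j with M i j in ij | r i in ri | r j in rj | M-bit i j | r-bit i | r-bit j
    ... | _ | _ | _ | bit0 | _    | _    = refl
    ... | _ | _ | _ | bit1 | bit0 | bit0 = refl
    ... | _ | _ | _ | bit1 | bit0 | bit1 = refl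
    ... | _ | _ | _ | bit1 | bit1 | bit0 = refl
    ... | _ | _ | _ | bit1 | bit1 | bit1 = ⊥-elim (no-edge (i , j , (ri , rj) , ij))
    form≡0 : form M r r ≡ 0ℤ
    form≡0 = trans (form-pairs M r r) (sum-zero _ λ i → sum-zero _ (vanish i))

  turán : ∀ r → (∀ j → Bit (r j)) → + 3 * form M r r ≤ + 2 * (sum r * sum r)
  turán r r-bit = turán-below (ℕ.suc ℤ.∣ sum r ∣) r r-bit
    (i≤pred[j]⇒i<j (≤-reflexive (sym (0≤i⇒+∣i∣≡i (sum-nonneg r (bit-nonneg ∘ r-bit))))))

-- Rounding weights to sets

module Rounding {n} (M : Fin n → Fin n → ℤ) (M-nonneg : ∀ i j → 0ℤ ≤ M i j)
                (M-sym : ∀ i j → M i j ≡ M j i) (M-diag : ∀ i → M i i ≡ 0ℤ)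
                (D k E : ℤ) (0<D : 0ℤ < D) where

  -- Weights in [0 , 1] are multiplied by a common denominator `D` to stay in ℤ; `k` is the size of
  -- the set to be found, and forms are scaled by D².
  record Admissible (f : Fin n → ℤ) : Set where
    field
      lower : ∀ l → 0ℤ ≤ f l
      upper : ∀ l → f l ≤ D
      mass  : sum f ≡ D * k
      small : form M f f ≤ E

  Extreme : (Fin n → ℤ) → Fin n → Set
  Extreme f l = f l ≡ 0ℤ ⊎ f l ≡ D

  transfer : Fin n → Fin n → ℤ → (Fin n → ℤ) → Fin n → ℤ
  transfer i j t f l = 1ℤ * f l + t * (1ℤ * pt i l + -1ℤ * pt j l)

  module _ {i j : Fin n} (i≢j : i ≢ j) (t : ℤ) (f : Fin n → ℤ) where

    private
      f′ = transfer i j t f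
      dipole : Fin n → ℤ
      dipole l = 1ℤ * pt i l + -1ℤ * pt j l

    transfer-source : f′ i ≡ f i + t
    transfer-source = trans (cong₂ (λ x y → 1ℤ * f i + t * (1ℤ * x + -1ℤ * y)) (pt-self i) (pt-other (i≢j ∘ sym)))
      (lemma (f i) t)
      where lemma : ∀ x t → 1ℤ * x + t * (1ℤ * 1ℤ + -1ℤ * 0ℤ) ≡ x + t
            lemma = solve-∀

    transfer-sink : f′ j ≡ f j - t
    transfer-sink = trans (cong₂ (λ x y → 1ℤ * f j + t * (1ℤ * x + -1ℤ * y)) (pt-other i≢j) (pt-self j)) (lemma (f j) t)
      where lemma : ∀ x t → 1ℤ * x + t * (1ℤ * 0ℤ + -1ℤ * 1ℤ) ≡ x - t
            lemma = solve-∀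

    transfer-other : ∀ {l} → l ≢ i → l ≢ j → f′ l ≡ f l
    transfer-other {l} l≢i l≢j = trans
      (cong₂ (λ x y → 1ℤ * f l + t * (1ℤ * x + -1ℤ * y)) (pt-other (l≢i ∘ sym)) (pt-other (l≢j ∘ sym))) (lemma (f l) t)
      where lemma : ∀ x t → 1ℤ * x + t * (1ℤ * 0ℤ + -1ℤ * 0ℤ) ≡ x
            lemma = solve-∀

    transfer-sum : sum f′ ≡ sum f
    transfer-sum = begin
      sum f′                                           ≡⟨ sum-lin₂ 1ℤ t f dipole ⟩
      1ℤ * sum f + t * sum dipole                      ≡⟨ cong (λ z → 1ℤ * sum f + t * z)
        (trans (sum-lin₂ 1ℤ -1ℤ (pt i) (pt j)) (cong₂ (λ x y → 1ℤ * x + -1ℤ * y) (sum-pt-1 i) (sum-pt-1 j))) ⟩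
      1ℤ * sum f + t * (1ℤ * 1ℤ + -1ℤ * 1ℤ)            ≡⟨ lemma (sum f) t ⟩
      sum f                                            ∎
      where
      open ≡-Reasoning
      lemma : ∀ x t → 1ℤ * x + t * (1ℤ * 1ℤ + -1ℤ * 1ℤ) ≡ x
      lemma = solve-∀

    transfer-form : form M f′ f′ ≡ form M f f + + 2 * t * (row M i f - row M j f) - + 2 * (t * t) * M i j
    transfer-form = begin
      form M f′ f′ ≡⟨ form-sq M M-sym 1ℤ t f dipole ⟩
      1ℤ * 1ℤ * form M f f + + 2 *
        (1ℤ * t) * form M f dipole + t * t * form M dipole dipole ≡⟨ cong₂
        (λ x y → 1ℤ * 1ℤ * form M f f + + 2 * (1ℤ * t) * x + t * t * y) linear quadratic ⟩
      1ℤ * 1ℤ * form M f f + + 2 * (1ℤ * t) * (1ℤ * row M i f + -1ℤ * row M j f) + t * t *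
        (1ℤ * 1ℤ * 0ℤ + + 2 * (1ℤ * -1ℤ) * M i j + -1ℤ * -1ℤ * 0ℤ) ≡⟨ lemma (form M f f) t (row M i f) (row M j f)
        (M i j) ⟩
      form M f f + + 2 * t * (row M i f - row M j f) - + 2 * (t * t) * M i j ∎
      where
      open ≡-Reasoning
      lemma : ∀ x t a b m → 1ℤ * 1ℤ * x + + 2 * (1ℤ * t) * (1ℤ * a + -1ℤ * b) + t * t *
        (1ℤ * 1ℤ * 0ℤ + + 2 * (1ℤ * -1ℤ) * m + -1ℤ * -1ℤ * 0ℤ) ≡ x + + 2 * t * (a - b) - + 2 * (t * t) * m
      lemma = solve-∀
      form-pt : ∀ a b → form M (pt a) (pt b) ≡ M a b
      form-pt a b = trans (form-ptˡ M a (pt b)) (row-pt M a b)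
      linear : form M f dipole ≡ 1ℤ * row M i f + -1ℤ * row M j f
      linear = trans (form-sym M M-sym f dipole)
        (trans (form-linˡ M 1ℤ -1ℤ (pt i) (pt j) f)
        (cong₂ (λ x y → 1ℤ * x + -1ℤ * y) (form-ptˡ M i f) (form-ptˡ M j f)))
      quadratic : form M dipole dipole ≡ 1ℤ * 1ℤ * 0ℤ + + 2 * (1ℤ * -1ℤ) * M i j + -1ℤ * -1ℤ * 0ℤ
      quadratic = trans (form-sq M M-sym 1ℤ -1ℤ (pt i) (pt j))
        (cong₂ _+_ (cong₂ (λ x y → 1ℤ * 1ℤ * x + + 2 * (1ℤ * -1ℤ) * y) (trans (form-pt i i) (M-diag i)) (form-pt i j))
                   (cong (λ z → -1ℤ * -1ℤ * z) (trans (form-pt j j) (M-diag j))))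

  -- Moving `t` from `j` to `i` changes the form by a linear term in `t`, which the comparison of
  -- the two rows makes nonpositive, and by `- 2 * t² * M i j`. A transfer in this direction
  -- therefore never increases the form, whatever the size of `t`.
  transfer-admissible : ∀ {i j f} → i ≢ j → Admissible f → row M i f ≤ row M j f →
                        ∀ t → 0ℤ ≤ t → t ≤ D - f i → t ≤ f j → Admissible (transfer i j t f)
  transfer-admissible {i} {j} {f} i≢j adm Lᵢ≤Lⱼ t 0≤t t≤D-fᵢ t≤fⱼ = record
    { lower = lower′
    ; upper = upper′
    ; mass  = trans (transfer-sum i≢j t f) mass
    ; small = ≤-trans
      (0≤i-j⇒j≤i (0≤-resp (sym descent)
      (0≤+ (0≤* (0≤* {+ 2} (+≤+ ℕ.z≤n) 0≤t) (i≤j⇒0≤j-i Lᵢ≤Lⱼ))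
      (0≤* (0≤* {+ 2} (+≤+ ℕ.z≤n) (0≤sq t)) (M-nonneg i j))))) small
    }
    where
    open Admissible adm
    f′ = transfer i j t f
    descent : form M f f - form M f′ f′ ≡ + 2 * t * (row M j f - row M i f) + + 2 * (t * t) * M i j
    descent = trans (cong (λ z → form M f f - z) (transfer-form i≢j t f))
      (lemma (form M f f) t (row M i f) (row M j f) (M i j))
      where lemma : ∀ x t a b m → x - (x + + 2 * t * (a - b) - + 2 * (t * t) * m) ≡ + 2 * t * (b - a) + + 2 *
              (t * t) * m
            lemma = solve-∀
    lower′ : ∀ l → 0ℤ ≤ f′ l
    lower′ l with l Fin.≟ i | l Fin.≟ j
    ... | yes refl | _        = 0≤-resp (sym (transfer-source i≢j t f)) (0≤+ (lower l) 0≤t)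
    ... | no _     | yes refl = 0≤-resp (sym (transfer-sink i≢j t f)) (i≤j⇒0≤j-i t≤fⱼ)
    ... | no l≢i   | no l≢j   = 0≤-resp (sym (transfer-other i≢j t f l≢i l≢j)) (lower l)
    upper′ : ∀ l → f′ l ≤ D
    upper′ l with l Fin.≟ i | l Fin.≟ j
    ... | yes refl | _        = subst (_≤ D) (sym (transfer-source i≢j t f))
            (0≤i-j⇒j≤i (0≤-resp (lemma D (f l) t) (i≤j⇒0≤j-i t≤D-fᵢ)))
      where lemma : ∀ d x t → d - x - t ≡ d - (x + t)
            lemma = solve-∀
    ... | no _     | yes refl = subst (_≤ D) (sym (transfer-sink i≢j t f))
            (0≤i-j⇒j≤i (0≤-resp (lemma D (f l) t) (0≤+ (i≤j⇒0≤j-i (upper l)) 0≤t)))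
      where lemma : ∀ d x t → d - x + t ≡ d - (x - t)
            lemma = solve-∀
    ... | no l≢i   | no l≢j   = subst (_≤ D) (sym (transfer-other i≢j t f l≢i l≢j)) (upper l)

  Improved : Fin n → Fin n → (Fin n → ℤ) → Set
  Improved i j f = ∃ λ f′ → Admissible f′ × (∀ l → l ≢ i → l ≢ j → f′ l ≡ f l) × (Extreme f′ i ⊎ Extreme f′ j)

  -- The largest possible transfer, the minimum of `D - f i` and `f j`, either fills `i` or empties
  -- `j`.
  improve-towards : ∀ {i j f} → i ≢ j → Admissible f → row M i f ≤ row M j f → Improved i j f
  improve-towards {i} {j} {f} i≢j adm Lᵢ≤Lⱼ with ≤-total (D - f i) (f j)
  ... | inj₁ D-fᵢ≤fⱼ = _ , transfer-admissible i≢j adm Lᵢ≤Lⱼ (D - f i)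
          (i≤j⇒0≤j-i (Admissible.upper adm i)) ≤-refl D-fᵢ≤fⱼ
                      , (λ l → transfer-other i≢j (D - f i) f) , inj₁
                        (inj₂ (trans (transfer-source i≢j (D - f i) f) (lemma (f i) D)))
    where lemma : ∀ x d → x + (d - x) ≡ d
          lemma = solve-∀
  ... | inj₂ fⱼ≤D-fᵢ = _ , transfer-admissible i≢j adm Lᵢ≤Lⱼ (f j) (Admissible.lower adm j) fⱼ≤D-fᵢ ≤-refl
                      , (λ l → transfer-other i≢j (f j) f) , inj₂
                        (inj₁ (trans (transfer-sink i≢j (f j) f) (+-inverseʳ (f j))))

  improve : ∀ {i j f} → i ≢ j → Admissible f → Improved i j f
  improve {i} {j} {f} i≢j adm with ≤-total (row M i f) (row M j f)
  ... | inj₁ Lᵢ≤Lⱼ = improve-towards i≢j adm Lᵢ≤Lⱼ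
  ... | inj₂ Lⱼ≤Lᵢ with improve-towards (i≢j ∘ sym) adm Lⱼ≤Lᵢ
  ...   | f′ , adm′ , same , inj₁ extⱼ = f′ , adm′ , (λ l l≢i l≢j → same l l≢j l≢i) , inj₂ extⱼ
  ...   | f′ , adm′ , same , inj₂ extᵢ = f′ , adm′ , (λ l l≢i l≢j → same l l≢j l≢i) , inj₁ extᵢ

  -- All vertices above m but the pending vertex p are settled; a transfer between p and the
  -- next vertex settles one of the two and leaves the other one pending.
  ExtremeAbove : ℕ → Fin n → (Fin n → ℤ) → Set
  ExtremeAbove m p f = ∀ l → m ℕ.≤ toℕ l → l ≢ p → Extreme f l

  sweep : ∀ m → m ℕ.≤ n → ∀ p f → Admissible f → ExtremeAbove m p f →
          ∃ λ q → ∃ λ f′ → Admissible f′ × (∀ l → l ≢ q → Extreme f′ l)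
  sweep ℕ.zero    _    p f adm ext = p , f , adm , λ l → ext l ℕ.z≤n
  sweep (ℕ.suc m) m<n p f adm ext with fromℕ< m<n Fin.≟ p | toℕ-fromℕ< m<n
  ... | yes refl | toℕp≡m = sweep m (ℕ.<⇒≤ m<n) p f adm λ l m≤l l≢p →
          ext l (ℕ.≤∧≢⇒< m≤l λ m≡l → l≢p (toℕ-injective (trans (sym m≡l) (sym toℕp≡m)))) l≢p
  ... | no i≢p | toℕi≡m with improve i≢p adm
  ...   | f′ , adm′ , same , extreme = next extreme
    where
    i = fromℕ< m<n
    above : ∀ l → m ℕ.≤ toℕ l → l ≢ i → ℕ.suc m ℕ.≤ toℕ l
    above l m≤l l≢i = ℕ.≤∧≢⇒< m≤l λ m≡l → l≢i (toℕ-injective (trans (sym m≡l) (sym toℕi≡m)))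
    keep : ∀ l → m ℕ.≤ toℕ l → l ≢ i → l ≢ p → Extreme f′ l
    keep l m≤l l≢i l≢p = subst (λ z → z ≡ 0ℤ ⊎ z ≡ D) (sym (same l l≢i l≢p)) (ext l (above l m≤l l≢i) l≢p)
    next : Extreme f′ i ⊎ Extreme f′ p → ∃ λ q → ∃ λ f′ → Admissible f′ × (∀ l → l ≢ q → Extreme f′ l)
    next (inj₁ extᵢ) = sweep m (ℕ.<⇒≤ m<n) p f′ adm′ go
      where go : ExtremeAbove m p f′
            go l m≤l l≢p with l Fin.≟ i
            ... | yes refl = extᵢ
            ... | no  l≢i  = keep l m≤l l≢i l≢p
    next (inj₂ extₚ) = sweep m (ℕ.<⇒≤ m<n) i f′ adm′ go
      where go : ExtremeAbove m i f′
            go l m≤l l≢i with l Fin.≟ p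
            ... | yes refl = extₚ
            ... | no  l≢p  = keep l m≤l l≢i l≢p

  zero-or-one : ∀ z → 0ℤ ≤ D * z → D * z ≤ D → z ≡ 0ℤ ⊎ z ≡ 1ℤ
  zero-or-one z 0≤Dz Dz≤D = bounded z (0≤-cancel D 0<D 0≤Dz) (0≤-cancel D 0<D (0≤-resp (lemma D z) (i≤j⇒0≤j-i Dz≤D)))
    where
    lemma : ∀ d z → d - d * z ≡ d * (1ℤ - z)
    lemma = solve-∀
    bounded : ∀ z → 0ℤ ≤ z → 0ℤ ≤ 1ℤ - z → z ≡ 0ℤ ⊎ z ≡ 1ℤ
    bounded (+ 0)                 _ _  = inj₁ refl
    bounded (+ 1)                 _ _  = inj₂ refl
    bounded (+ ℕ.suc (ℕ.suc _)) _ ()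

  -- The total and all other weights are multiples of `D`. So the remaining weight is one too, and
  -- it lies between 0 and `D`.
  last-extreme : ∀ q f → Admissible f → (∀ l → l ≢ q → Extreme f l) → ∀ l → Extreme f l
  last-extreme q f adm ext l with l Fin.≟ q
  ... | no  l≢q  = ext l l≢q
  ... | yes refl = finish (zero-or-one (k - sum b) (subst (0ℤ ≤_) f≡ (lower l)) (subst (_≤ D) f≡ (upper l)))
    where
    open Admissible adm
    b : Fin n → ℤ
    b i with i Fin.≟ l
    ... | yes _   = 0ℤ
    ... | no  i≢l = [ (λ _ → 0ℤ) , (λ _ → 1ℤ) ]′ (ext i i≢l)
    split : ∀ i → f i ≡ D * b i + f l * pt l i
    split i with i Fin.≟ l
    ... | yes refl = sym (trans (cong (λ z → D * 0ℤ + f l * z) (pt-self l)) (lemma D (f l)))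
      where lemma : ∀ d x → d * 0ℤ + x * 1ℤ ≡ x
            lemma = solve-∀
    ... | no i≢l with ext i i≢l
    ...   | inj₁ fᵢ≡0 = trans fᵢ≡0 (sym (trans (cong (λ z → D * 0ℤ + f l * z) (pt-other (i≢l ∘ sym))) (lemma D (f l))))
      where lemma : ∀ d x → d * 0ℤ + x * 0ℤ ≡ 0ℤ
            lemma = solve-∀
    ...   | inj₂ fᵢ≡D = trans fᵢ≡D (sym (trans (cong (λ z → D * 1ℤ + f l * z) (pt-other (i≢l ∘ sym))) (lemma D (f l))))
      where lemma : ∀ d x → d * 1ℤ + x * 0ℤ ≡ d
            lemma = solve-∀
    f≡ : f l ≡ D * (k - sum b)
    f≡ = trans (isolate (f l) (D * sum b)) (trans (cong (_- D * sum b) (trans (sym total) mass)) (collect D k (sum b)))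
      where
      isolate : ∀ x y → x ≡ (y + x * 1ℤ) - y
      isolate = solve-∀
      collect : ∀ d k s → d * k - d * s ≡ d * (k - s)
      collect = solve-∀
      total : sum f ≡ D * sum b + f l * 1ℤ
      total = trans (sum-cong split) (trans (sum-lin₂ D (f l) b (pt l)) (cong (λ z → D * sum b + f l * z) (sum-pt-1 l)))
    finish : k - sum b ≡ 0ℤ ⊎ k - sum b ≡ 1ℤ → Extreme f l
    finish (inj₁ z≡0) = inj₁ (trans f≡ (trans (cong (D *_) z≡0) (*-zeroʳ D)))
    finish (inj₂ z≡1) = inj₂ (trans f≡ (trans (cong (D *_) z≡1) (*-identityʳ D)))

  round : Fin n → ∀ f → Admissible f →
          ∃ λ χ → (∀ l → Bit (χ l)) × sum χ ≡ k × D * D * form M χ χ ≤ E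
  -- No vertex has index `n` or more, so nothing need be settled at the start and any vertex can be
  -- the pending one.
  round v f adm with sweep n ℕ.≤-refl v f adm (λ l n≤l → contradiction (toℕ<n l) (ℕ.≤⇒≯ n≤l))
  ... | q , f′ , adm′ , ext = χ , (λ l → ind-bit (f′ l ≟ D)) , mass-χ , small-χ
    where
    open Admissible adm′
    χ : Fin n → ℤ
    χ l = ind (f′ l ≟ D)
    scaled : ∀ l → f′ l ≡ D * χ l + 0ℤ * χ l
    scaled l with f′ l ≟ D | last-extreme q f′ adm′ ext l
    ... | yes f≡D | _        = trans f≡D (sym (trans (+-identityʳ (D * 1ℤ)) (*-identityʳ D)))
    ... | no  _   | inj₁ f≡0 = trans f≡0 (sym (trans (+-identityʳ (D * 0ℤ)) (*-zeroʳ D)))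
    ... | no  f≢D | inj₂ f≡D = contradiction f≡D f≢D
    mass-χ : sum χ ≡ k
    mass-χ = *-cancelˡ-≡ D (sum χ) k {{≢-nonZero λ D≡0 → <-irrefl (sym D≡0) 0<D}}
      (trans (lemma D (sum χ)) (trans (sym (sum-lin₂ D 0ℤ χ χ)) (trans (sym (sum-cong scaled)) mass)))
      where lemma : ∀ d s → d * s ≡ d * s + 0ℤ * s
            lemma = solve-∀
    small-χ : D * D * form M χ χ ≤ E
    small-χ = subst (_≤ E)
      (trans (form-cong M scaled scaled) (trans (form-sq M M-sym D 0ℤ χ χ) (lemma D (form M χ χ)))) small
      where lemma : ∀ d x → d * d * x + + 2 * (d * 0ℤ) * x + 0ℤ * 0ℤ * x ≡ d * d * x
            lemma = solve-∀

-- Codegrees in a K₄-free regular graph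

complement-form : ∀ {n} (M : Fin n → Fin n → ℤ) f g →
                  form (λ i j → 1ℤ + -1ℤ * M i j) f g ≡ sum f * sum g - form M f g
complement-form M f g = begin
  sum (λ i → f i * sum (λ j → (1ℤ + -1ℤ * M i j) * g j))
    ≡⟨ sum-cong (λ i → trans (cong (f i *_) (trans (sum-cong λ j → spread (M i j) (g j)) (sum-lin₂ 1ℤ -1ℤ g _)))
      (gather (f i) (sum g) (row M i g))) ⟩
  sum (λ i → sum g * f i + -1ℤ * (f i * row M i g))
    ≡⟨ sum-lin₂ (sum g) -1ℤ f _ ⟩
  sum g * sum f + -1ℤ * form M f g
    ≡⟨ finish (sum f) (sum g) (form M f g) ⟩
  sum f * sum g - form M f g ∎
  where
  open ≡-Reasoning
  spread : ∀ m y → (1ℤ + -1ℤ * m) * y ≡ 1ℤ * y + -1ℤ * (m * y)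
  spread = solve-∀
  gather : ∀ x s r → x * (1ℤ * s + -1ℤ * r) ≡ s * x + -1ℤ * (x * r)
  gather = solve-∀
  finish : ∀ a b c → b * a + -1ℤ * c ≡ a * b - c
  finish = solve-∀

-- Twice the right-hand side is the sum of `N i j * (p i * p j) * (A i + ε * A j)²`. For ε = -1 it
-- is the Laplacian of `N` with vertex weights `p`, evaluated at `A`; for ε = 1 it is the signless
-- Laplacian.
square-form : ∀ {n} (N : Fin n → Fin n → ℤ) → (∀ i j → 0ℤ ≤ N i j) → (∀ i j → N i j ≡ N j i) →
              ∀ ε → ε * ε ≡ 1ℤ → (p A : Fin n → ℤ) → (∀ i → 0ℤ ≤ p i) →
              0ℤ ≤ form N (λ i → p i * (A i * A i)) p + ε * form N (λ i → p i * A i) (λ i → p i * A i)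
square-form N N≥0 N-sym ε ε²≡1 p A p≥0 = 0≤-cancel (+ 2) (+<+ (ℕ.s≤s ℕ.z≤n)) (0≤-resp expand
    (sum-nonneg _ λ i → sum-nonneg _ λ j → 0≤* (0≤* (N≥0 i j) (0≤* (p≥0 i) (p≥0 j))) (0≤sq (A i + ε * A j))))
  where
  pA² = λ i → p i * (A i * A i)
  pA  = λ i → p i * A i
  regroup : ∀ m x y a b e → m * (x * y) * ((a + e * b) * (a + e * b)) ≡
            1ℤ * (m * (x * (a * a) * y)) + + 2 * e * (m * (x * a * (y * b))) + e * e * (m * (x * (y * (b * b))))
  regroup = solve-∀
  double : ∀ s e t → 1ℤ * s + + 2 * e * t + 1ℤ * s ≡ + 2 * (s + e * t)
  double = solve-∀
  expand : (sum λ i → sum λ j → N i j * (p i * p j) * ((A i + ε * A j) * (A i + ε * A j))) ≡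
           + 2 * (form N pA² p + ε * form N pA pA)
  expand = trans
    (sum-cong λ i → trans (sum-cong λ j → regroup (N i j) (p i) (p j) (A i) (A j) ε)
    (sum-lin₃ 1ℤ (+ 2 * ε) (ε * ε) _ _ _))
    (trans (sum-lin₃ 1ℤ (+ 2 * ε) (ε * ε) _ _ _)
    (trans (cong₂ _+_ (cong₂ (λ y z → 1ℤ * y + + 2 * ε * z) (sym (form-pairs N pA² p)) (sym (form-pairs N pA pA)))
                      (cong₂ _*_ ε²≡1 (trans (sym (form-pairs N p pA²)) (form-sym N N-sym p pA²))))
           (double (form N pA² p) ε (form N pA pA))))

-- With ξ > 0 the amount by which the test fails, quad is ξ times a positive form plus its
-- value 2a² + 2d²b at the threshold, where b is a positive definite form in N and d.
module Sparse (N d x : ℤ) (0<d : 0ℤ < d) (fail : + 4 * (N * N) - + 17 * (N * d) + + 22 * (d * d) < + 9 * x) where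

  private
    ξ = + 9 * x - (+ 4 * (N * N) - + 17 * (N * d) + + 22 * (d * d))
    0<ξ : 0ℤ < ξ
    0<ξ = <⇒0<- fail

  -- The threshold form is positive definite, its discriminant being 17² - 4 · 4 · 22 = -63, so
  -- exceeding it forces a positive `x`.
  x-pos : 0ℤ < x
  x-pos = 0<-cancel (+ 144) (+≤+ ℕ.z≤n) (subst (0ℤ <_) (sym (identity N d x))
      (+-mono-<-≤ (+-mono-<-≤ (0<* {+ 16} (+<+ (ℕ.s≤s ℕ.z≤n)) 0<ξ) (0≤sq (+ 8 * N - + 17 * d)))
        (0≤* {+ 63} (+≤+ ℕ.z≤n) (0≤sq d))))
    where identity : ∀ N d x → + 144 * x ≡ + 16 * (+ 9 * x - (+ 4 * (N * N) - + 17 * (N * d) + + 22 * (d * d))) +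
            (+ 8 * N - + 17 * d) * (+ 8 * N - + 17 * d) + + 63 * (d * d)
          identity = solve-∀

  κ-nonneg : 0ℤ ≤ + 12 * (N * d) - + 33 * (d * d) + + 36 * x
  κ-nonneg = 0≤-resp (sym (identity N d x))
    (0≤+ (0≤+ (0≤* {+ 4} (+≤+ ℕ.z≤n) (<⇒≤ 0<ξ)) (0≤sq (+ 4 * N - + 7 * d))) (0≤* {+ 6} (+≤+ ℕ.z≤n) (0≤sq d)))
    where identity : ∀ N d x → + 12 * (N * d) - + 33 * (d * d) + + 36 * x ≡
                               + 4 * (+ 9 * x - (+ 4 * (N * N) - + 17 * (N * d) + + 22 * (d * d))) +
                                 (+ 4 * N - + 7 * d) * (+ 4 * N - + 7 * d) + + 6 * (d * d)
          identity = solve-∀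

  quad-pos : 0ℤ < + 18 * (x * x) + (+ 12 * (N * d) - + 27 * (d * d)) * x - (+ 2 * (N * N) - + 3 * (N * d)) * (d * d)
  quad-pos = 0<-cancel (+ 9) (+≤+ ℕ.z≤n) (subst (0ℤ <_) (sym identity)
      (+-mono-<-≤ (+-mono-≤-< (0≤+ (0≤* {+ 2} (+≤+ ℕ.z≤n) (0≤sq (a N d))) (0≤* {+ 2} (+≤+ ℕ.z≤n) (0≤* (0≤sq d) 0≤b)))
                              (0<* 0<ξ (+-mono-≤-< (0≤sq (+ 4 * N - + 7 * d))
                                (0<* {+ 12} (+<+ (ℕ.s≤s ℕ.z≤n)) (0<* 0<d 0<d)))))
                  (0≤* {+ 2} (+≤+ ℕ.z≤n) (0≤sq ξ))))
    where
    T a b : ℤ → ℤ → ℤ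
    T N d = + 4 * (N * N) - + 17 * (N * d) + + 22 * (d * d)
    a N d = + 4 * (N * N) - + 14 * (N * d) + + 12 * (d * d)
    b N d = + 43 * (d * d) - + 37 * (N * d) + + 8 * (N * N)
    0≤b : 0ℤ ≤ b N d
    -- Completing the square with 172 = 4 · 43; the discriminant is 37² - 4 · 8 · 43 = -7.
    0≤b = 0≤-cancel (+ 172) (+<+ (ℕ.s≤s ℕ.z≤n))
      (0≤-resp (sym (square N d)) (0≤+ (0≤sq (+ 86 * d - + 37 * N)) (0≤* {+ 7} (+≤+ ℕ.z≤n) (0≤sq N))))
      where square : ∀ N d → + 172 * (+ 43 * (d * d) - + 37 * (N * d) + + 8 * (N * N)) ≡ (+ 86 * d - + 37 * N) *
              (+ 86 * d - + 37 * N) + + 7 * (N * N)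
            square = solve-∀
    scale : ∀ N d x → + 9 *
      (+ 18 * (x * x) + (+ 12 * (N * d) - + 27 * (d * d)) * x - (+ 2 * (N * N) - + 3 * (N * d)) * (d * d)) ≡
            + 2 * (+ 9 * x * (+ 9 * x)) + (+ 12 * (N * d) - + 27 * (d * d)) * (+ 9 * x) - + 9 *
              ((+ 2 * (N * N) - + 3 * (N * d)) * (d * d))
    scale = solve-∀
    at-threshold : ∀ N d ξ →
      let Y = + 4 * (N * N) - + 17 * (N * d) + + 22 * (d * d) + ξ
          a = + 4 * (N * N) - + 14 * (N * d) + + 12 * (d * d)
          b = + 43 * (d * d) - + 37 * (N * d) + + 8 * (N * N) in
      + 2 * (Y * Y) + (+ 12 * (N * d) - + 27 * (d * d)) * Y - + 9 * ((+ 2 * (N * N) - + 3 * (N * d)) * (d * d)) ≡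
      + 2 * (a * a) + + 2 * (d * d * b) + ξ * ((+ 4 * N - + 7 * d) * (+ 4 * N - + 7 * d) + + 12 * (d * d)) + + 2 *
        (ξ * ξ)
    at-threshold = solve-∀
    identity : + 9 *
      (+ 18 * (x * x) + (+ 12 * (N * d) - + 27 * (d * d)) * x - (+ 2 * (N * N) - + 3 * (N * d)) * (d * d)) ≡
      + 2 * (a N d * a N d) + + 2 * (d * d * b N d) + ξ *
        ((+ 4 * N - + 7 * d) * (+ 4 * N - + 7 * d) + + 12 * (d * d)) + + 2 * (ξ * ξ)
    identity = trans (scale N d x)
      (trans (cong
      (λ Y → + 2 * (Y * Y) + (+ 12 * (N * d) - + 27 * (d * d)) * Y - + 9 * ((+ 2 * (N * N) - + 3 * (N * d)) * (d * d)))
      (recover (+ 9 * x) (T N d))) (at-threshold N d ξ))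
      where recover : ∀ y t → y ≡ t + (y - t)
            recover = solve-∀

-- At the threshold ξ = 0, quad is a multiple of (3e - N)² (3d - N) with e = N - d; the double
-- root e = N / 3 is the balanced complete tripartite graph.
module Dense (N d x : ℤ) (0<N : 0ℤ < N) (0<d : 0ℤ < d) (N<2d : N < + 2 * d) (0≤x : 0ℤ ≤ x)
             (fail : d * (N * N) < + 9 * x * (N - d)) where

  private
    e = N - d
    ξ = + 9 * x * e - d * (N * N)
    0<ξ : 0ℤ < ξ
    0<ξ = <⇒0<- fail
    0<e : 0ℤ < e
    0<e = 0<-cancel (+ 9 * x) (0≤* {+ 9} (+≤+ ℕ.z≤n) 0≤x) (<-trans (0<* 0<d (0<* 0<N 0<N)) fail)

  x-pos : 0ℤ < x
  x-pos = 0<-cancel (+ 9 * e) (0≤* {+ 9} (+≤+ ℕ.z≤n) (<⇒≤ 0<e))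
    (subst (0ℤ <_) (reorder x e) (<-trans (0<* 0<d (0<* 0<N 0<N)) fail))
    where reorder : ∀ x e → + 9 * x * e ≡ + 9 * e * x
          reorder = solve-∀

  κ-nonneg : 0ℤ ≤ + 12 * (N * d) - + 33 * (d * d) + + 36 * x
  κ-nonneg = 0≤-cancel (+ 16 * e) (0<* {+ 16} (+<+ (ℕ.s≤s ℕ.z≤n)) 0<e) (0≤-resp (sym (identity N d x))
      (0≤+ (0≤* (<⇒≤ 0<d) (0≤+ (0≤sq (+ 8 * N - + 21 * e)) (0≤* {+ 87} (+≤+ ℕ.z≤n) (0≤sq e))))
        (0≤* {+ 64} (+≤+ ℕ.z≤n) (<⇒≤ 0<ξ))))
    where identity : ∀ N d x → let e = N - d in
                     + 16 * e * (+ 12 * (N * d) - + 33 * (d * d) + + 36 * x) ≡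
                     d * ((+ 8 * N - + 21 * e) * (+ 8 * N - + 21 * e) + + 87 * (e * e)) + + 64 *
                       (+ 9 * x * e - d * (N * N))
          identity = solve-∀

  quad-pos : 0ℤ < + 18 * (x * x) + (+ 12 * (N * d) - + 27 * (d * d)) * x - (+ 2 * (N * N) - + 3 * (N * d)) * (d * d)
  -- The factor 81 e² clears the denominator of x = (d N² + ξ) / (9 e), which turns `quad` into a
  -- polynomial in `N`, `d` and `ξ`.
  quad-pos = 0<-cancel (+ 81 * (e * e)) (0≤* {+ 81} (+≤+ ℕ.z≤n) (0≤sq e)) (subst (0ℤ <_) (sym (identity N d x))
      (+-mono-≤-< (0≤+ (0≤* (0≤* {+ 9} (+≤+ ℕ.z≤n) (0≤* (0≤* (0≤sq d) (<⇒≤ 0<N)) (0≤sq (+ 3 * e - N)))) 0≤3d-N)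
                       (0≤* (0≤* (<⇒≤ 0<ξ) (<⇒≤ 0<d))
                         (0≤* {+ 9} (+≤+ ℕ.z≤n)
                         (0≤+ (0≤+ (0≤sq (+ 2 * N - + 4 * e)) (0≤* (<⇒≤ 0<e) (<⇒≤ 0<N)))
                         (0≤* {+ 11} (+≤+ ℕ.z≤n) (0≤sq e))))))
                  (0<* {+ 18} (+<+ (ℕ.s≤s ℕ.z≤n)) (0<* 0<ξ 0<ξ))))
    where
    0≤3d-N : 0ℤ ≤ + 3 * d - N
    0≤3d-N = 0≤-resp (split d N) (0≤+ (<⇒≤ 0<d) (<⇒≤ (<⇒0<- N<2d)))
      where split : ∀ d N → d + (+ 2 * d - N) ≡ + 3 * d - N
            split = solve-∀
    identity : ∀ N d x → let e = N - d
                             ξ = + 9 * x * e - d * (N * N) in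
      + 81 * (e * e) *
        (+ 18 * (x * x) + (+ 12 * (N * d) - + 27 * (d * d)) * x - (+ 2 * (N * N) - + 3 * (N * d)) * (d * d)) ≡
      + 9 * (d * d * N * ((+ 3 * e - N) * (+ 3 * e - N))) * (+ 3 * d - N)
      + ξ * d * (+ 9 * ((+ 2 * N - + 4 * e) * (+ 2 * N - + 4 * e) + e * N + + 11 * (e * e))) + + 18 * (ξ * ξ)
    identity = solve-∀

-- Moments of the codegrees at a vertex

module Regular {n} (M : Fin n → Fin n → ℤ) (M-bit : ∀ i j → Bit (M i j))
               (M-sym : ∀ i j → M i j ≡ M j i) (M-diag : ∀ i → M i i ≡ 0ℤ)
               (M-free : ∀ i j k l → M i j ≡ 1ℤ → M i k ≡ 1ℤ → M i l ≡ 1ℤ →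
                         M j k ≡ 1ℤ → M j l ≡ 1ℤ → M k l ≡ 1ℤ → ⊥)
               (d : ℤ) (M-reg : ∀ i → sum (M i) ≡ d) where

  open Turán M M-bit M-sym M-diag M-free

  N : ℤ
  N = + n

  M-nonneg : ∀ i j → 0ℤ ≤ M i j
  M-nonneg i j = bit-nonneg (M-bit i j)

  codeg : Fin n → Fin n → ℤ
  codeg u v = row M v (M u)

  codeg-sym : ∀ u v → codeg u v ≡ codeg v u
  codeg-sym u v = sum-cong λ z → *-comm (M v z) (M u z)

  meet : Fin n → Fin n → Fin n → ℤ
  meet u v z = M v z * M u z

  meet-sym : ∀ u v z → meet u v z ≡ meet v u z
  meet-sym u v z = *-comm (M v z) (M u z)

  -- Twice the number of edges inside N(u). Since `row M v (M u)` is `codeg u v` by definition, it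
  -- unfolds to the sum of the codegrees of `u` with its neighbours: the first moment, which `H₂`
  -- and `H₃` continue.
  x : Fin n → ℤ
  x u = form M (M u) (M u)

  -- Equivalently, the sum of `codeg u z` over the common neighbours `z` of `u` and `v`. It is not
  -- symmetric in `u` and `v`.
  s : Fin n → Fin n → ℤ
  s u v = form M (meet u v) (M u)

  Ph : Fin n → Fin n → ℤ
  Ph u v = M u v * codeg u v

  H₂ H₃ W : Fin n → ℤ
  H₂ u = sum λ v → M u v * (codeg u v * codeg u v)
  H₃ u = sum λ v → M u v * (codeg u v * codeg u v * codeg u v)
  W  u = form M (Ph u) (Ph u)

  form-Ph-M : ∀ u → form M (Ph u) (M u) ≡ H₂ u
  form-Ph-M u = sum-cong λ v → *-assoc (M u v) (codeg u v) (codeg u v)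

  deg-nonneg : Fin n → 0ℤ ≤ d
  deg-nonneg u = 0≤-resp (M-reg u) (sum-nonneg (M u) (M-nonneg u))

  x-nonneg : ∀ u → 0ℤ ≤ x u
  x-nonneg u = form-nonneg M M-nonneg (M u) (M u) (M-nonneg u) (M-nonneg u)

  co-bit : ∀ {b} → Bit b → 0ℤ ≤ 1ℤ + -1ℤ * b
  co-bit bit0 = +≤+ ℕ.z≤n
  co-bit bit1 = +≤+ ℕ.z≤n

  codeg≤d : ∀ u v → 0ℤ ≤ d - codeg u v
  codeg≤d u v = 0≤-resp expand (sum-nonneg _ λ z → 0≤* (M-nonneg v z) (co-bit (M-bit u z)))
    where
    spread : ∀ a b → a * (1ℤ + -1ℤ * b) ≡ 1ℤ * a + -1ℤ * (a * b)
    spread = solve-∀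
    finish : ∀ a b → 1ℤ * a + -1ℤ * b ≡ a - b
    finish = solve-∀
    expand : (sum λ z → M v z * (1ℤ + -1ℤ * M u z)) ≡ d - codeg u v
    expand = trans (sum-cong λ z → spread (M v z) (M u z)) (trans (sum-lin₂ 1ℤ -1ℤ (M v) _)
      (trans (cong (λ y → 1ℤ * y + -1ℤ * codeg u v) (M-reg v)) (finish d (codeg u v))))

  x≤d² : ∀ u → 0ℤ ≤ d * d - x u
  x≤d² u = 0≤-resp expand (sum-nonneg _ λ v → 0≤* (M-nonneg u v) (codeg≤d u v))
    where
    spread : ∀ a b c → a * (b - c) ≡ b * a + -1ℤ * (a * c)
    spread = solve-∀
    finish : ∀ a b → a * a + -1ℤ * b ≡ a * a - b
    finish = solve-∀
    expand : (sum λ v → M u v * (d - codeg u v)) ≡ d * d - x u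
    expand = trans (sum-cong λ v → spread (M u v) d (codeg u v)) (trans (sum-lin₂ d -1ℤ (M u) _)
      (trans (cong (λ y → d * y + -1ℤ * x u) (M-reg u)) (finish d (x u))))

  -- Inclusion-exclusion: the difference counts the vertices outside both neighbourhoods.
  2d-N≤codeg : ∀ u v → 0ℤ ≤ codeg u v - (+ 2 * d - N)
  2d-N≤codeg u v = 0≤-resp expand (sum-nonneg _ λ z → 0≤* (co-bit (M-bit v z)) (co-bit (M-bit u z)))
    where
    spread : ∀ a b → (1ℤ + -1ℤ * a) * (1ℤ + -1ℤ * b) ≡ 1ℤ * (1ℤ * 1ℤ + -1ℤ * a) + 1ℤ * (-1ℤ * b + 1ℤ * (a * b))
    spread = solve-∀
    finish : ∀ n d c → 1ℤ * (1ℤ * (n * 1ℤ) + -1ℤ * d) + 1ℤ * (-1ℤ * d + 1ℤ * c) ≡ c - (+ 2 * d - n)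
    finish = solve-∀
    expand : (sum λ z → (1ℤ + -1ℤ * M v z) * (1ℤ + -1ℤ * M u z)) ≡ codeg u v - (+ 2 * d - N)
    expand = trans (sum-cong λ z → spread (M v z) (M u z)) (trans (sum-lin₂ 1ℤ 1ℤ _ _)
      (trans (cong₂ (λ y z → 1ℤ * y + 1ℤ * z)
        (trans (sum-lin₂ 1ℤ -1ℤ (λ _ → 1ℤ) (M v)) (cong₂ (λ y z → 1ℤ * y + -1ℤ * z) (sum-const n 1ℤ) (M-reg v)))
        (trans (sum-lin₂ -1ℤ 1ℤ (M u) _) (cong (λ y → -1ℤ * y + 1ℤ * codeg u v) (M-reg u))))
      (finish N d (codeg u v))))

  cauchy-schwarz : 0ℤ < d → ∀ u → 0ℤ ≤ d * H₂ u - x u * x u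
  cauchy-schwarz 0<d u = 0≤-cancel d 0<d
    (0≤-resp expand (sum-nonneg _ λ v → 0≤* (M-nonneg u v) (0≤sq (d * codeg u v - x u))))
    where
    spread : ∀ d x m c → m * ((d * c - x) * (d * c - x)) ≡ d * d * (m * (c * c)) + - (+ 2 * d * x) * (m * c) + x * x * m
    spread = solve-∀
    finish : ∀ d x h → d * d * h + - (+ 2 * d * x) * x + x * x * d ≡ d * (d * h - x * x)
    finish = solve-∀
    expand : (sum λ v → M u v * ((d * codeg u v - x u) * (d * codeg u v - x u))) ≡ d * (d * H₂ u - x u * x u)
    expand = trans (sum-cong λ v → spread d (x u) (M u v) (codeg u v))
      (trans (sum-lin₃ (d * d) (- (+ 2 * d * x u)) (x u * x u) _ _ (M u))
      (trans (cong (λ y → d * d * H₂ u + - (+ 2 * d * x u) * x u + x u * x u * y) (M-reg u)) (finish d (x u) (H₂ u))))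

  form-cube : ∀ u → form M (λ v → M u v * (codeg u v * codeg u v)) (M u) ≡ H₃ u
  form-cube u = sum-cong λ v → *-assoc (M u v) (codeg u v * codeg u v) (codeg u v)

  -- The Laplacian of the graph induced on the d vertices of N(u) is at most d, because its
  -- complement has a nonnegative Laplacian as well.
  difference-bound : ∀ u → 0ℤ ≤ W u + d * H₂ u - H₃ u - x u * x u
  difference-bound u = 0≤-resp expand
    (square-form co (λ i j → co-bit (M-bit i j)) (λ i j → cong (λ z → 1ℤ + -1ℤ * z) (M-sym i j)) -1ℤ refl (M u)
      (codeg u) (M-nonneg u))
    where
    co : Fin n → Fin n → ℤ
    -- The complement has loops here, but with ε = -1 their squares vanish.
    co i j = 1ℤ + -1ℤ * M i j
    finish : ∀ w d h k x → (h * d - k) + -1ℤ * (x * x - w) ≡ w + d * h - k - x * x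
    finish = solve-∀
    expand : form co (λ v → M u v * (codeg u v * codeg u v)) (M u) + -1ℤ * form co (Ph u)
      (Ph u) ≡ W u + d * H₂ u - H₃ u - x u * x u
    expand = trans (cong₂ (λ y z → y + -1ℤ * z)
        (trans (complement-form M _ (M u)) (cong₂ (λ y z → H₂ u * y - z) (M-reg u) (form-cube u)))
        (complement-form M (Ph u) (Ph u)))
      (finish (W u) d (H₂ u) (H₃ u) (x u))

  -- Nonnegativity of the signless Laplacian, applied to the codegrees centred at their mean x / d.
  sum-bound : ∀ u → 0ℤ ≤ d * d * (H₃ u + W u) - + 4 * d * x u * H₂ u + + 2 * x u * x u * x u
  sum-bound u = 0≤-resp expand (square-form M M-nonneg M-sym 1ℤ refl (M u) A (M-nonneg u))
    where
    A : Fin n → ℤ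
    A v = d * codeg u v - x u
    spread : ∀ d x m c → m * ((d * c - x) * (d * c - x)) * c ≡ d * d * (m * (c * c * c)) + - (+ 2 * d * x) *
      (m * (c * c)) + x * x * (m * c)
    spread = solve-∀
    affine : ∀ d x m c → m * (d * c - x) ≡ d * (m * c) + - x * m
    affine = solve-∀
    finish : ∀ d x h k w → (d * d * k + - (+ 2 * d * x) * h + x * x * x) + 1ℤ *
      (d * d * w + + 2 * (d * - x) * h + - x * - x * x) ≡
                           d * d * (k + w) - + 4 * d * x * h + + 2 * x * x * x
    finish = solve-∀
    cubic : form M (λ v → M u v * (A v * A v)) (M u) ≡ d * d * H₃ u + - (+ 2 * d * x u) * H₂ u + x u * x u * x u
    cubic = trans (sum-cong λ v → spread d (x u) (M u v) (codeg u v))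
      (sum-lin₃ (d * d) (- (+ 2 * d * x u)) (x u * x u) _ _ _)
    quadratic : form M (λ v → M u v * A v) (λ v → M u v * A v) ≡ d * d * W u + + 2 *
      (d * - x u) * H₂ u + - x u * - x u * x u
    quadratic = trans
      (form-cong M (λ v → affine d (x u) (M u v) (codeg u v)) (λ v → affine d (x u) (M u v) (codeg u v)))
      (trans (form-sq M M-sym d (- x u) (Ph u) (M u))
        (cong (λ z → d * d * W u + + 2 * (d * - x u) * z + - x u * - x u * x u) (form-Ph-M u)))
    expand = trans (cong₂ (λ y z → y + 1ℤ * z) cubic quadratic) (finish d (x u) (H₂ u) (H₃ u) (W u))

  bracket : Fin n → ℤ
  bracket u = + 24 * W u + (+ 12 * N - + 18 * d) * H₂ u - + 6 * H₃ u - + 9 * (x u * x u) -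
    (+ 2 * (N * N) - + 3 * (N * d)) * x u

  quad : Fin n → ℤ
  quad u = + 18 * (x u * x u) + (+ 12 * (N * d) - + 27 * (d * d)) * x u - (+ 2 * (N * N) - + 3 * (N * d)) * (d * d)

  -- `difference-bound` and `sum-bound` have to reproduce 24 `W` - 6 `H₃`, up to the factor d².
  -- Their multipliers 15 d² and 9 are forced by 15 + 9 = 24 and 9 - 15 = -6. What remains of `H₂`
  -- has `d` times the quantity in `0≤κ` as coefficient, so Cauchy-Schwarz may replace `H₂` by its
  -- lower bound x² / d. The rest is `x u * quad u`.
  bracket-pos : 0ℤ < d → ∀ u → 0ℤ < x u → 0ℤ ≤ + 12 * (N * d) - + 33 *
    (d * d) + + 36 * x u → 0ℤ < quad u → 0ℤ < bracket u
  bracket-pos 0<d u 0<x 0≤κ 0<q = 0<-cancel (d * d) (0≤sq d)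
    (subst (0ℤ <_) (sym (combine d N (x u) (H₂ u) (H₃ u) (W u)))
    (+-mono-≤-< (0≤+
      (0≤+ (0≤* (0≤* {+ 15} (+≤+ ℕ.z≤n) (0≤sq d)) (difference-bound u)) (0≤* {+ 9} (+≤+ ℕ.z≤n) (sum-bound u)))
                     (0≤* 0≤κ (cauchy-schwarz 0<d u)))
                (0<* 0<x 0<q)))
    where
    combine : ∀ d N x h k w →
      d * d * (+ 24 * w + (+ 12 * N - + 18 * d) * h - + 6 * k - + 9 * (x * x) - (+ 2 * (N * N) - + 3 * (N * d)) * x) ≡
      + 15 * (d * d) * (w + d * h - k - x * x) + + 9 * (d * d * (k + w) - + 4 * d * x * h + + 2 * x * x * x)
      + (+ 12 * (N * d) - + 33 * (d * d) + + 36 * x) * (d * h - x * x)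
      + x * (+ 18 * (x * x) + (+ 12 * (N * d) - + 27 * (d * d)) * x - (+ 2 * (N * N) - + 3 * (N * d)) * (d * d))
    combine = solve-∀

  -- Edge counts around a triangle

  meet-bit : ∀ u v z → Bit (meet u v z)
  meet-bit u v z = bit-* (M-bit v z) (M-bit u z)

  meet-independent : ∀ {u v} → M u v ≡ 1ℤ → form M (meet u v) (meet u v) ≡ 0ℤ
  meet-independent {u} {v} uv = trans (form-pairs M (meet u v) (meet u v)) (sum-zero _ λ i → sum-zero _ (vanish i))
    where
    vanish : ∀ i j → M i j * (M v i * M u i * (M v j * M u j)) ≡ 0ℤ
    vanish i j with M i j in ij | M v i in vi | M u i in ui | M v j in vj | M u j in uj
                  | M-bit i j | M-bit v i | M-bit u i | M-bit v j | M-bit u j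
    ... | _ | _ | _ | _ | _ | bit0 | _ | _ | _ | _ = refl
    ... | _ | _ | _ | _ | _ | bit1 | bit0 | _ | _ | _ = refl
    ... | _ | _ | _ | _ | _ | bit1 | bit1 | bit0 | _ | _ = refl
    ... | _ | _ | _ | _ | _ | bit1 | bit1 | bit1 | bit0 | _ = refl
    ... | _ | _ | _ | _ | _ | bit1 | bit1 | bit1 | bit1 | bit0 = refl
    ... | _ | _ | _ | _ | _ | bit1 | bit1 | bit1 | bit1 | bit1 = ⊥-elim (M-free u v i j uv ui uj vi vj ij)

  form-1 : ∀ f → form M f (λ _ → 1ℤ) ≡ d * sum f
  form-1 f = trans
    (sum-cong λ i → trans (cong (f i *_) (trans (sum-cong λ j → *-identityʳ (M i j)) (M-reg i))) (*-comm (f i) d))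
    (sum-* d f)

  -- For a triangle the two sets are disjoint, and this is the number of edges between them: the
  -- quantity that has to cancel.
  common : Fin n → Fin n → Fin n → ℤ
  common u v w = form M (meet u v) (meet u w)

  module _ {u v w : Fin n} (uv : M u v ≡ 1ℤ) (uw : M u w ≡ 1ℤ) (vw : M v w ≡ 1ℤ) where

    not-all : ∀ z → M u z ≡ 1ℤ → M v z ≡ 1ℤ → M w z ≡ 1ℤ → ⊥
    not-all z uz vz wz = M-free u v w z uv uw uz vw vz wz

    -- The right-hand side is the form of `rest`, the part of N(u) outside N(v) and N(w). No vertex
    -- is subtracted twice because the two common neighbourhoods are disjoint, and their own squares
    -- drop out because they are independent.
    private-bound : 0ℤ ≤ x u + + 2 * common u v w - + 2 * (s u v + s u w)
    private-bound = 0≤-resp expand (form-nonneg M M-nonneg rest rest rest-nonneg rest-nonneg)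
      where
      both rest : Fin n → ℤ
      both z = 1ℤ * meet u v z + 1ℤ * meet u w z
      rest z = 1ℤ * M u z + -1ℤ * both z
      rest-nonneg : ∀ z → 0ℤ ≤ rest z
      rest-nonneg z with M u z in uz | M v z in vz | M w z in wz | M-bit u z | M-bit v z | M-bit w z
      ... | _ | _ | _ | bit0 | bit0 | bit0 = +≤+ ℕ.z≤n
      ... | _ | _ | _ | bit0 | bit0 | bit1 = +≤+ ℕ.z≤n
      ... | _ | _ | _ | bit0 | bit1 | bit0 = +≤+ ℕ.z≤n
      ... | _ | _ | _ | bit0 | bit1 | bit1 = +≤+ ℕ.z≤n
      ... | _ | _ | _ | bit1 | bit0 | bit0 = +≤+ ℕ.z≤n
      ... | _ | _ | _ | bit1 | bit0 | bit1 = +≤+ ℕ.z≤n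
      ... | _ | _ | _ | bit1 | bit1 | bit0 = +≤+ ℕ.z≤n
      ... | _ | _ | _ | bit1 | bit1 | bit1 = ⊥-elim (not-all z uz vz wz)
      finish : ∀ x s k → 1ℤ * 1ℤ * x + + 2 * (1ℤ * -1ℤ) * s + -1ℤ * -1ℤ *
        (1ℤ * 1ℤ * 0ℤ + + 2 * (1ℤ * 1ℤ) * k + 1ℤ * 1ℤ * 0ℤ) ≡ x + + 2 * k - + 2 * s
      finish = solve-∀
      ones : ∀ a b → 1ℤ * a + 1ℤ * b ≡ a + b
      ones = solve-∀
      linear : form M (M u) both ≡ s u v + s u w
      linear = trans (form-sym M M-sym (M u) both)
        (trans (form-linˡ M 1ℤ 1ℤ (meet u v) (meet u w) (M u)) (ones (s u v) (s u w)))
      square : form M both both ≡ 1ℤ * 1ℤ * 0ℤ + + 2 * (1ℤ * 1ℤ) * common u v w + 1ℤ * 1ℤ * 0ℤ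
      square = trans (form-sq M M-sym 1ℤ 1ℤ (meet u v) (meet u w))
        (cong₂ (λ y z → 1ℤ * 1ℤ * y + + 2 * (1ℤ * 1ℤ) * common u v w + 1ℤ * 1ℤ * z) (meet-independent uv)
          (meet-independent uw))
      expand : form M rest rest ≡ x u + + 2 * common u v w - + 2 * (s u v + s u w)
      expand = trans (form-sq M M-sym 1ℤ -1ℤ (M u) both)
        (trans (cong₂ (λ y z → 1ℤ * 1ℤ * x u + + 2 * (1ℤ * -1ℤ) * y + -1ℤ * -1ℤ * z) linear square)
          (finish (x u) (s u v + s u w) (common u v w)))

    -- Turán's theorem for `remote`, the vertices in none of the three disjoint common
    -- neighbourhoods; regularity expresses its form through codegrees and `common`. Each `common`
    -- has coefficient -6 here and 2 in `private-bound`, so three copies of each private bound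
    -- cancel it.
    overlap-bound : 0ℤ ≤ + 2 * ((N - (codeg u v + codeg u w + codeg v w)) * (N - (codeg u v + codeg u w + codeg v w)))
                         - + 3 * (d * N) + + 6 * d * (codeg u v + codeg u w + codeg v w) - + 6 *
                           (common u v w + common v u w + common w u v)
    overlap-bound = 0≤-resp expand (i≤j⇒0≤j-i (turán remote remote-bit))
      where
      two twice remote : Fin n → ℤ
      two z = 1ℤ * meet u v z + 1ℤ * meet u w z
      twice z = 1ℤ * two z + 1ℤ * meet v w z
      remote z = 1ℤ * 1ℤ + -1ℤ * twice z
      remote-bit : ∀ z → Bit (remote z)
      remote-bit z with M u z in uz | M v z in vz | M w z in wz | M-bit u z | M-bit v z | M-bit w z
      ... | _ | _ | _ | bit0 | bit0 | bit0 = bit1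
      ... | _ | _ | _ | bit0 | bit0 | bit1 = bit1
      ... | _ | _ | _ | bit0 | bit1 | bit0 = bit1
      ... | _ | _ | _ | bit0 | bit1 | bit1 = bit0
      ... | _ | _ | _ | bit1 | bit0 | bit0 = bit1
      ... | _ | _ | _ | bit1 | bit0 | bit1 = bit0
      ... | _ | _ | _ | bit1 | bit1 | bit0 = bit0
      ... | _ | _ | _ | bit1 | bit1 | bit1 = ⊥-elim (not-all z uz vz wz)
      c = codeg u v + codeg u w + codeg v w
      k = common u v w + common v u w + common w u v
      ones₂ : ∀ a b → 1ℤ * a + 1ℤ * b ≡ a + b
      ones₂ = solve-∀
      sum-twice : sum twice ≡ c
      sum-twice = trans (sum-lin₂ 1ℤ 1ℤ two (meet v w)) (trans (ones₂ (sum two) (codeg v w))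
        (cong (_+ codeg v w) (trans (sum-lin₂ 1ℤ 1ℤ (meet u v) (meet u w)) (ones₂ (codeg u v) (codeg u w)))))
      sum-remote : sum remote ≡ N - c
      sum-remote = trans (sum-lin₂ 1ℤ -1ℤ (λ _ → 1ℤ) twice)
        (trans (cong₂ (λ y z → 1ℤ * y + -1ℤ * z) (sum-const n 1ℤ) sum-twice) (simplify N c))
        where simplify : ∀ a b → 1ℤ * (a * 1ℤ) + -1ℤ * b ≡ a - b
              simplify = solve-∀
      form-twice : form M twice twice ≡ + 2 * k
      form-twice = trans (form-sq M M-sym 1ℤ 1ℤ two (meet v w))
        (trans (cong₂ _+_ (cong₂ (λ y z → 1ℤ * 1ℤ * y + + 2 * (1ℤ * 1ℤ) * z)
                  (trans (form-sq M M-sym 1ℤ 1ℤ (meet u v) (meet u w))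
                    (cong₂ (λ y z → 1ℤ * 1ℤ * y + + 2 * (1ℤ * 1ℤ) * common u v w + 1ℤ * 1ℤ * z)
                    (meet-independent uv) (meet-independent uw)))
                  (trans (form-linˡ M 1ℤ 1ℤ (meet u v) (meet u w) (meet v w))
                    (cong₂ (λ y z → 1ℤ * y + 1ℤ * z)
                      (form-cong M (meet-sym u v) λ _ → refl)
                      (form-cong M (meet-sym u w) (meet-sym v w)))))
                (cong (λ z → 1ℤ * 1ℤ * z) (meet-independent vw)))
          (simplify (common u v w) (common v u w) (common w u v)))
        where simplify : ∀ a b c → 1ℤ * 1ℤ * (1ℤ * 1ℤ * 0ℤ + + 2 * (1ℤ * 1ℤ) * a + 1ℤ * 1ℤ * 0ℤ) + + 2 *
                (1ℤ * 1ℤ) * (1ℤ * b + 1ℤ * c) + 1ℤ * 1ℤ * 0ℤ ≡ + 2 * (a + b + c)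
              simplify = solve-∀
      form-remote : form M remote remote ≡ d * N - + 2 * (d * c) + + 2 * k
      form-remote = trans (form-sq M M-sym 1ℤ -1ℤ (λ _ → 1ℤ) twice)
        (trans (cong₂ _+_ (cong₂ (λ y z → 1ℤ * 1ℤ * y + + 2 * (1ℤ * -1ℤ) * z)
                  (trans (form-1 (λ _ → 1ℤ)) (cong (d *_) (sum-const n 1ℤ)))
                  (trans (form-sym M M-sym (λ _ → 1ℤ) twice) (trans (form-1 twice) (cong (d *_) sum-twice))))
                (cong (λ z → -1ℤ * -1ℤ * z) form-twice))
          (simplify d N c k))
        where simplify : ∀ d n c k → 1ℤ * 1ℤ * (d * (n * 1ℤ)) + + 2 * (1ℤ * -1ℤ) * (d * c) + -1ℤ * -1ℤ *
                (+ 2 * k) ≡ d * n - + 2 * (d * c) + + 2 * k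
              simplify = solve-∀
      expand : + 2 * (sum remote * sum remote) - + 3 * form M remote remote ≡ + 2 * ((N - c) * (N - c)) - + 3 *
        (d * N) + + 6 * d * c - + 6 * k
      expand = trans (cong₂ (λ y z → + 2 * (y * y) - + 3 * z) sum-remote form-remote) (simplify N d c k)
        where simplify : ∀ n d c k → + 2 * ((n - c) * (n - c)) - + 3 * (d * n - + 2 * (d * c) + + 2 * k) ≡ + 2 *
                ((n - c) * (n - c)) - + 3 * (d * n) + + 6 * d * c - + 6 * k
              simplify = solve-∀

  -- Averaging over all triangles

  τ : Fin n → Fin n → Fin n → ℤ
  τ u v w = M v w * (M u v * M u w)

  triangles : (Fin n → Fin n → Fin n → ℤ) → ℤ
  triangles F = sum λ u → sum λ v → sum λ w → τ u v w * F u v w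

  triangles-swap₂₃ : ∀ F → triangles F ≡ triangles (λ u v w → F u w v)
  triangles-swap₂₃ F = sum-cong λ u → trans (sum-swap _) (sum-cong λ v → sum-cong λ w →
    cong (_* F u w v) (trans (cong (_* (M u w * M u v)) (M-sym w v)) (cong (M v w *_) (*-comm (M u w) (M u v)))))

  triangles-swap₁₂ : ∀ F → triangles F ≡ triangles (λ u v w → F v u w)
  triangles-swap₁₂ F = trans (sum-swap _) (sum-cong λ u → sum-cong λ v → sum-cong λ w →
    cong (_* F v u w) (trans (cong (λ z → M u w * (z * M v w)) (M-sym v u)) (rotate (M u w) (M u v) (M v w))))
    where rotate : ∀ a b c → a * (b * c) ≡ c * (b * a)
          rotate = solve-∀

  triangles-+ : ∀ F G → triangles (λ u v w → F u v w + G u v w) ≡ triangles F + triangles G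
  triangles-+ F G = trans
    (sum-cong λ u → trans
    (sum-cong λ v → trans (sum-cong λ w → *-distribˡ-+ (τ u v w) (F u v w) (G u v w)) (sum-+ _ _)) (sum-+ _ _))
    (sum-+ _ _)

  triangles-nonneg : ∀ F → (∀ u v w → M u v ≡ 1ℤ → M u w ≡ 1ℤ → M v w ≡ 1ℤ → 0ℤ ≤ F u v w) → 0ℤ ≤ triangles F
  triangles-nonneg F F≥0 = sum-nonneg _ λ u → sum-nonneg _ λ v → sum-nonneg _ λ w → term u v w
    where
    term : ∀ u v w → 0ℤ ≤ τ u v w * F u v w
    term u v w with M v w in vw | M u v in uv | M u w in uw | M-bit v w | M-bit u v | M-bit u w
    ... | _ | _ | _ | bit0 | _    | _    = ≤-refl
    ... | _ | _ | _ | bit1 | bit0 | _    = ≤-refl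
    ... | _ | _ | _ | bit1 | bit1 | bit0 = ≤-refl
    ... | _ | _ | _ | bit1 | bit1 | bit1 = 0≤-resp (sym (*-identityˡ (F u v w))) (F≥0 u v w uv uw vw)

  -- Over the six orderings of a triangle, excess adds up to six times the overlap-bound plus
  -- eighteen times the private-bounds of its three vertices.
  excess : Fin n → Fin n → Fin n → ℤ
  excess u v w = + 9 * x u + (+ 2 * (N * N) - + 3 * (N * d)) + (+ 18 * d - + 12 * N) * codeg u v
                 + + 6 * (codeg u v * codeg u v) - + 36 * s u v + + 12 * (codeg u v * codeg u w)

  E₂ E₃ E₄ E₅ E₆ symmetrised : Fin n → Fin n → Fin n → ℤ
  E₂ u v w = excess u w v
  E₃ u v w = excess v u w
  E₄ u v w = excess v w u
  E₅ u v w = excess w u v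
  E₆ u v w = excess w v u
  symmetrised u v w = ((excess u v w + E₂ u v w) + (E₃ u v w + E₅ u v w)) + (E₄ u v w + E₆ u v w)

  -- `τ` is invariant under permuting its arguments, and the two transpositions generate all six
  -- orderings.
  triangles-symmetrised : triangles symmetrised ≡ + 6 * triangles excess
  triangles-symmetrised = begin
    triangles symmetrised
      ≡⟨ triangles-+ (λ u v w → (excess u v w + E₂ u v w) + (E₃ u v w + E₅ u v w)) (λ u v w → E₄ u v w + E₆ u v w) ⟩
    triangles (λ u v w → (excess u v w + E₂ u v w) + (E₃ u v w + E₅ u v w)) + triangles (λ u v w → E₄ u v w + E₆ u v w)
      ≡⟨ cong₂ _+_ (triangles-+ (λ u v w → excess u v w + E₂ u v w) (λ u v w → E₃ u v w + E₅ u v w))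
        (triangles-+ E₄ E₆) ⟩
    (triangles (λ u v w → excess u v w + E₂ u v w) + triangles (λ u v w → E₃ u v w + E₅ u v w)) +
      (triangles E₄ + triangles E₆)
      ≡⟨ cong (_+ (triangles E₄ + triangles E₆)) (cong₂ _+_ (triangles-+ excess E₂) (triangles-+ E₃ E₅)) ⟩
    ((triangles excess + triangles E₂) + (triangles E₃ + triangles E₅)) + (triangles E₄ + triangles E₆)
      ≡⟨ cong₂ _+_ (cong₂ _+_ (cong (λ z → triangles excess + z) (sym e₂)) (cong₂ _+_ (sym e₃) (sym e₅)))
        (cong₂ _+_ (sym e₄) (sym e₆)) ⟩
    ((triangles excess + triangles excess) + (triangles excess + triangles excess)) +
      (triangles excess + triangles excess)
      ≡⟨ six (triangles excess) ⟩
    + 6 * triangles excess ∎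
    where
    open ≡-Reasoning
    six : ∀ t → ((t + t) + (t + t)) + (t + t) ≡ + 6 * t
    six = solve-∀
    e₂ : triangles excess ≡ triangles E₂
    e₂ = triangles-swap₂₃ excess
    e₃ : triangles excess ≡ triangles E₃
    e₃ = triangles-swap₁₂ excess
    e₄ : triangles excess ≡ triangles E₄
    e₄ = trans e₂ (triangles-swap₁₂ E₂)
    e₅ : triangles excess ≡ triangles E₅
    e₅ = trans e₃ (triangles-swap₂₃ E₃)
    e₆ : triangles excess ≡ triangles E₆
    e₆ = trans e₄ (triangles-swap₂₃ E₄)

  symmetrised-nonneg : ∀ u v w → M u v ≡ 1ℤ → M u w ≡ 1ℤ → M v w ≡ 1ℤ → 0ℤ ≤ symmetrised u v w
  symmetrised-nonneg u v w uv uw vw = 0≤-resp (sym expand)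
    (0≤* {+ 6} (+≤+ ℕ.z≤n) (0≤+ (0≤* {+ 3} (+≤+ ℕ.z≤n)
      (0≤+ (0≤+ (private-bound uv uw vw) (private-bound vu vw uw)) (private-bound wu wv uv))) (overlap-bound uv uw vw)))
    where
    vu = trans (M-sym v u) uv
    wu = trans (M-sym w u) uw
    wv = trans (M-sym w v) vw
    Σc = codeg u v + codeg u w + codeg v w
    sixfold : ∀ N d x₁ x₂ x₃ c₁ c₂ c₃ s₁ s₂ s₃ s₄ s₅ s₆ k₁ k₂ k₃ →
      let C = + 2 * (N * N) - + 3 * (N * d)
          B = + 18 * d - + 12 * N
          t : ℤ → ℤ → ℤ → ℤ → ℤ
          t = λ x c c′ s → + 9 * x + C + B * c + + 6 * (c * c) - + 36 * s + + 12 * (c * c′)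
          c = c₁ + c₂ + c₃ in
      ((t x₁ c₁ c₂ s₁ + t x₁ c₂ c₁ s₂) + (t x₂ c₁ c₃ s₃ + t x₃ c₂ c₃ s₅)) + (t x₂ c₃ c₁ s₄ + t x₃ c₃ c₂ s₆) ≡
      + 6 * (+ 3 * ((x₁ + + 2 * k₁ - + 2 * (s₁ + s₂)) + (x₂ + + 2 * k₂ - + 2 * (s₃ + s₄)) +
        (x₃ + + 2 * k₃ - + 2 * (s₅ + s₆)))
             + (+ 2 * ((N - c) * (N - c)) - + 3 * (d * N) + + 6 * d * c - + 6 * (k₁ + k₂ + k₃)))
    sixfold = solve-∀
    t : ℤ → ℤ → ℤ → ℤ → ℤ
    t x c c′ s = + 9 * x + (+ 2 * (N * N) - + 3 * (N * d)) + (+ 18 * d - + 12 * N) * c + + 6 *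
      (c * c) - + 36 * s + + 12 * (c * c′)
    expand : symmetrised u v w ≡ + 6 *
      (+ 3 * ((x u + + 2 * common u v w - + 2 * (s u v + s u w)) +
      (x v + + 2 * common v u w - + 2 * (s v u + s v w)) + (x w + + 2 * common w u v - + 2 * (s w u + s w v)))
      + (+ 2 * ((N - Σc) * (N - Σc)) - + 3 * (d * N) + + 6 * d * Σc - + 6 *
        (common u v w + common v u w + common w u v)))
    expand = trans (cong₂ _+_ (cong₂ _+_ (refl {x = excess u v w + excess u w v})
                 (cong₂ _+_ (cong (λ c → t (x v) c (codeg v w) (s v u)) (codeg-sym v u))
                   (cong₂ (λ c c′ → t (x w) c c′ (s w u)) (codeg-sym w u) (codeg-sym w v))))
               (cong₂ _+_ (cong (λ c′ → t (x v) (codeg v w) c′ (s v w)) (codeg-sym v u))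
                 (cong₂ (λ c c′ → t (x w) c c′ (s w v)) (codeg-sym w v) (codeg-sym w u))))
      (sixfold N d (x u) (x v) (x w) (codeg u v) (codeg u w) (codeg v w) (s u v) (s u w) (s v u) (s v w) (s w u)
        (s w v) (common u v w) (common v u w) (common w u v))

  form-P-s : ∀ u → (sum λ v → M u v * s u v * codeg u v) ≡ W u
  form-P-s u = sum-cong λ v → trans
    (cong (λ z → M u v * z * codeg u v) (sum-cong λ z → *-assoc (M v z) (M u z) (codeg u z)))
    (exchange (M u v) (row M v (Ph u)) (codeg u v))
    where exchange : ∀ a b c → a * b * c ≡ a * c * b
          exchange = solve-∀

  -- For fixed `u` and `v` there are `codeg u v` choices of `w`, so each power of `codeg u v` rises
  -- by one and gives the next moment at `u`. The terms with `s` and with the product of two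
  -- codegrees both become `W`, with total coefficient -36 + 12 = -24.
  triangles-excess : triangles excess ≡ -1ℤ * sum bracket
  triangles-excess = trans (sum-cong local) (sum-* -1ℤ bracket)
    where
    L : Fin n → Fin n → ℤ
    L u v = + 9 * x u + (+ 2 * (N * N) - + 3 * (N * d)) + (+ 18 * d - + 12 * N) * codeg u v + + 6 *
      (codeg u v * codeg u v) - + 36 * s u v
    spread : ∀ m p q l c c′ → m * (p * q) * (l + + 12 * (c * c′)) ≡ 1ℤ * (m * (p * l * q)) + + 12 *
      (m * (p * c * (q * c′)))
    spread = solve-∀
    term : ∀ a b p c s → p * (a + b * c + + 6 * (c * c) - + 36 * s) * c ≡ 1ℤ *
      (a * (p * c) + b * (p * (c * c)) + + 6 * (p * (c * c * c))) + - (+ 36) * (p * s * c)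
    term = solve-∀
    finish : ∀ N d x h k w → 1ℤ *
      (1ℤ * ((+ 9 * x + (+ 2 * (N * N) - + 3 * (N * d))) * x + (+ 18 * d - + 12 * N) * h + + 6 * k) + -
      (+ 36) * w) + + 12 * w ≡
                             -1ℤ * (+ 24 * w + (+ 12 * N - + 18 * d) * h - + 6 * k - + 9 * (x * x) -
                               (+ 2 * (N * N) - + 3 * (N * d)) * x)
    finish = solve-∀
    linear : ∀ u → form M (λ v → M u v * L u v) (M u) ≡ 1ℤ *
      ((+ 9 * x u + (+ 2 * (N * N) - + 3 * (N * d))) * x u + (+ 18 * d - + 12 * N) * H₂ u + + 6 * H₃ u) + - (+ 36) * W u
    linear u = trans
      (sum-cong λ v → term (+ 9 * x u + (+ 2 * (N * N) - + 3 * (N * d))) (+ 18 * d - + 12 * N) (M u v) (codeg u v)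
      (s u v))
      (trans (sum-lin₂ 1ℤ (- (+ 36)) _ _)
        (cong₂ (λ y z → 1ℤ * y + - (+ 36) * z)
        (sum-lin₃ (+ 9 * x u + (+ 2 * (N * N) - + 3 * (N * d))) (+ 18 * d - + 12 * N) (+ 6) _ _ _) (form-P-s u)))
    local : ∀ u → (sum λ v → sum λ w → τ u v w * excess u v w) ≡ -1ℤ * bracket u
    local u = trans
      (sum-cong λ v → trans (sum-cong λ w → spread (M v w) (M u v) (M u w) (L u v) (codeg u v) (codeg u w))
      (sum-lin₂ 1ℤ (+ 12) _ _))
      (trans (sum-lin₂ 1ℤ (+ 12) _ _)
      (trans (cong₂ (λ y z → 1ℤ * y + + 12 * z)
        (trans (sym (form-pairs M (λ v → M u v * L u v) (M u))) (linear u)) (sym (form-pairs M (Ph u) (Ph u))))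
      (finish N d (x u) (H₂ u) (H₃ u) (W u))))

  sum-bracket≤0 : sum bracket ≤ 0ℤ
  sum-bracket≤0 = 0≤i-j⇒j≤i
    (0≤-cancel (+ 6) (+<+ (ℕ.s≤s ℕ.z≤n))
    (0≤-resp (trans triangles-symmetrised (cong (+ 6 *_) (trans triangles-excess (negate (sum bracket)))))
    (triangles-nonneg symmetrised symmetrised-nonneg)))
    where negate : ∀ b → -1ℤ * b ≡ 0ℤ - b
          negate = solve-∀

  -- Trial weights and the consequences of their failure

  module _ (v₀ : Fin n) (k : ℤ) (N≡2k : N ≡ + 2 * k) where

    0<N : 0ℤ < N
    0<N = +<+ (ℕ.≤-<-trans ℕ.z≤n (toℕ<n v₀))

    -- `form` counts every edge twice, so the last condition allows N² / 18 edges.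
    Half : Set
    Half = ∃ λ χ → (∀ l → Bit (χ l)) × sum χ ≡ k × + 9 * form M χ χ ≤ N * N

    half : ∀ D f → 0ℤ < D → (∀ l → 0ℤ ≤ f l) → (∀ l → f l ≤ D) → sum f ≡ D * k →
           + 9 * form M f f ≤ D * D * (N * N) → Half
    half D f 0<D lower upper mass 9f≤ =
      let χ , χ-bit , χ-mass , χ≤f = Rounding.round M M-nonneg M-sym M-diag D k (form M f f) 0<D v₀ f
                                       record { lower = lower ; upper = upper ; mass = mass ; small = ≤-refl }
      in χ , χ-bit , χ-mass , cancel-scale χ χ≤f
      where
      telescope : ∀ D² N² f χ → (D² * N² - + 9 * f) + + 9 * (f - D² * χ) ≡ D² * (N² - + 9 * χ)
      telescope = solve-∀
      cancel-scale : ∀ χ → D * D * form M χ χ ≤ form M f f → + 9 * form M χ χ ≤ N * N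
      cancel-scale χ χ≤f = 0≤i-j⇒j≤i (0≤-cancel (D * D) (0<* 0<D 0<D)
        (0≤-resp (telescope (D * D) (N * N) (form M f f) (form M χ χ))
          (0≤+ (i≤j⇒0≤j-i 9f≤) (0≤* {+ 9} (+≤+ ℕ.z≤n) (i≤j⇒0≤j-i χ≤f)))))

    all-brackets-pos⇒⊥ : (∀ u → 0ℤ < bracket u) → ⊥
    all-brackets-pos⇒⊥ 0<b = <⇒≱ (sum-pos v₀ bracket 0<b) sum-bracket≤0

    -- The condition 9 ⟨f , f⟩ ≤ D² N² for the weight in `sparse-round`, divided by N²: it reads 9
    -- (d N - 2 d² + x) ≤ 4 (N - d)².
    SparseGood : Fin n → Set
    SparseGood v = + 9 * x v ≤ + 4 * (N * N) - + 17 * (N * d) + + 22 * (d * d)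

    sparse-exists : ¬ ∃ SparseGood → ⊥
    sparse-exists none = all-brackets-pos⇒⊥ λ u →
      let open Sparse N d (x u) 0<d (fails u)
      in bracket-pos 0<d u x-pos κ-nonneg quad-pos
      where
      fails : ∀ u → + 4 * (N * N) - + 17 * (N * d) + + 22 * (d * d) < + 9 * x u
      fails u = ≰⇒> λ ≤ → none (u , ≤)
      0<d : 0ℤ < d
      -- For d = 0 the bound x ≤ d² gives x = 0, and the test succeeds.
      0<d = ≤∧≢⇒< (deg-nonneg v₀) λ 0≡d → <⇒≱
        (subst (λ z → + 4 * (N * N) - + 17 * (N * z) + + 22 * (z * z) < + 9 * x v₀) (sym 0≡d) (fails v₀))
        (≤-trans (0≤i-j⇒j≤i
          (0≤-resp (at-zero (x v₀)) (0≤* {+ 9} (+≤+ ℕ.z≤n) (subst (λ z → 0ℤ ≤ z * z - x v₀) (sym 0≡d) (x≤d² v₀)))))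
                 (0≤-resp (vanish N) (0≤* {+ 4} (+≤+ ℕ.z≤n) (0≤sq N))))
        where
        at-zero : ∀ x → + 9 * (0ℤ * 0ℤ - x) ≡ 0ℤ - + 9 * x
        at-zero = solve-∀
        vanish : ∀ N → + 4 * (N * N) ≡ + 4 * (N * N) - + 17 * (N * 0ℤ) + + 22 * (0ℤ * 0ℤ)
        vanish = solve-∀

    sparse-round : + 2 * d ≤ N → ∃ SparseGood → Half
    sparse-round 2d≤N (v , 9x≤) = half (+ 2 * (N - d)) f 0<D lower upper mass small
      where
      f : Fin n → ℤ
      -- Relative to D = 2 (N - d) this is N / (2 (N - d)) on the N - d vertices outside N(v), the
      -- constant with total N / 2. It is at most 1 because 2d ≤ N.
      f z = N * 1ℤ + - N * M v z
      0≤d = deg-nonneg v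
      0<D : 0ℤ < + 2 * (N - d)
      0<D = subst (0ℤ <_) (split N d) (+-mono-<-≤ 0<N (i≤j⇒0≤j-i 2d≤N))
        where split : ∀ N d → N + (N - + 2 * d) ≡ + 2 * (N - d)
              split = solve-∀
      lower : ∀ z → 0ℤ ≤ f z
      lower z = 0≤-resp (factor N (M v z)) (0≤* (<⇒≤ 0<N) (co-bit (M-bit v z)))
        where factor : ∀ N m → N * (1ℤ + -1ℤ * m) ≡ N * 1ℤ + - N * m
              factor = solve-∀
      upper : ∀ z → f z ≤ + 2 * (N - d)
      upper z = 0≤i-j⇒j≤i (0≤-resp (gap N d (M v z)) (0≤+ (i≤j⇒0≤j-i 2d≤N) (0≤* (<⇒≤ 0<N) (M-nonneg v z))))
        where gap : ∀ N d m → (N - + 2 * d) + N * m ≡ + 2 * (N - d) - (N * 1ℤ + - N * m)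
              gap = solve-∀
      mass : sum f ≡ + 2 * (N - d) * k
      mass = trans (sum-lin₂ N (- N) (λ _ → 1ℤ) (M v))
        (trans (cong₂ (λ y z → N * y + - N * z) (sum-const n 1ℤ) (M-reg v))
        (trans (factor N d) (trans (cong (_* (N - d)) N≡2k) (reorder k (N - d)))))
        where
        factor : ∀ N d → N * (N * 1ℤ) + - N * d ≡ N * (N - d)
        factor = solve-∀
        reorder : ∀ k e → + 2 * k * e ≡ + 2 * e * k
        reorder = solve-∀
      form-f : form M f f ≡ N * N * (d * N - + 2 * (d * d) + x v)
      form-f = trans (form-sq M M-sym N (- N) (λ _ → 1ℤ) (M v))
        (trans (cong₂ (λ y z → N * N * y + + 2 * (N * - N) * z + - N * - N * x v)
          (trans (form-1 (λ _ → 1ℤ)) (cong (d *_) (sum-const n 1ℤ)))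
          (trans (form-sym M M-sym (λ _ → 1ℤ) (M v)) (trans (form-1 (M v)) (cong (d *_) (M-reg v)))))
        (collect N d (x v)))
        where collect : ∀ N d x → N * N * (d * (N * 1ℤ)) + + 2 * (N * - N) * (d * d) + - N * - N * x ≡ N * N *
                (d * N - + 2 * (d * d) + x)
              collect = solve-∀
      small : + 9 * form M f f ≤ + 2 * (N - d) * (+ 2 * (N - d)) * (N * N)
      small = subst (λ z → + 9 * z ≤ + 2 * (N - d) * (+ 2 * (N - d)) * (N * N)) (sym form-f)
        (0≤i-j⇒j≤i (0≤-resp (expand N d (x v)) (0≤* (0≤sq N) (i≤j⇒0≤j-i 9x≤))))
        where expand : ∀ N d x → N * N * (+ 4 * (N * N) - + 17 * (N * d) + + 22 * (d * d) - + 9 * x) ≡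
                                 + 2 * (N - d) * (+ 2 * (N - d)) * (N * N) - + 9 * (N * N * (d * N - + 2 * (d * d) + x))
              expand = solve-∀

    -- The condition 9 ⟨f , f⟩ ≤ D² N² for the weight in `dense-round`, divided by 4 `codeg v w`.
    -- There is no term quadratic in 2d - N, since the common neighbourhood is independent.
    DenseGood : Fin n → Fin n → Set
    DenseGood v w = M v w ≡ 1ℤ × + 9 * (codeg v w * x v - (+ 2 * d - N) * s v w) ≤ codeg v w * (N * N)

    dense-round : N < + 2 * d → (∃ λ v → ∃ (DenseGood v)) → Half
    dense-round N<2d (v , w , vw , good) = half (+ 2 * c) f 0<D lower upper mass small
      where
      t c : ℤ
      t = + 2 * d - N
      c = codeg v w
      f : Fin n → ℤ
      -- Relative to D = 2c the weight on a common neighbour is 1 - t / (2c). The total excess of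
      -- N(v) over N / 2 is t / 2, spread evenly over the c common neighbours; t ≤ c keeps the
      -- weight nonnegative.
      f z = + 2 * c * M v z + - t * meet v w z
      0<t : 0ℤ < t
      0<t = <⇒0<- N<2d
      0<c : 0ℤ < c
      0<c = <-≤-trans 0<t (0≤i-j⇒j≤i (2d-N≤codeg v w))
      0<D : 0ℤ < + 2 * c
      0<D = 0<* {+ 2} (+<+ (ℕ.s≤s ℕ.z≤n)) 0<c
      0≤2c-t : 0ℤ ≤ c + (c - t)
      0≤2c-t = 0≤+ (<⇒≤ 0<c) (2d-N≤codeg v w)
      lower : ∀ z → 0ℤ ≤ f z
      lower z = 0≤-resp (regroup c t (M v z) (M w z))
        (0≤* (M-nonneg v z) (0≤+ (0≤* 0≤2c-t (M-nonneg w z)) (0≤* (<⇒≤ 0<D) (co-bit (M-bit w z)))))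
        where regroup : ∀ c t a b → a * ((c + (c - t)) * b + + 2 * c * (1ℤ + -1ℤ * b)) ≡ + 2 * c * a + - t * (b * a)
              regroup = solve-∀
      upper : ∀ z → f z ≤ + 2 * c
      upper z = 0≤i-j⇒j≤i (0≤-resp (regroup c t (M v z) (M w z))
        (0≤+ (0≤* (<⇒≤ 0<D) (co-bit (M-bit v z))) (0≤* (<⇒≤ 0<t) (bit-nonneg (meet-bit v w z)))))
        where regroup : ∀ c t a b → + 2 * c * (1ℤ + -1ℤ * a) + t * (b * a) ≡ + 2 * c - (+ 2 * c * a + - t * (b * a))
              regroup = solve-∀
      mass : sum f ≡ + 2 * c * k
      mass = trans (sum-lin₂ (+ 2 * c) (- t) (M v) (meet v w)) (trans (cong (λ y → + 2 * c * y + - t * c) (M-reg v))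
        (trans (cancel c d N) (trans (cong (c *_) N≡2k) (reorder c k))))
        where
        cancel : ∀ c d N → + 2 * c * d + - (+ 2 * d - N) * c ≡ c * N
        cancel = solve-∀
        reorder : ∀ c k → c * (+ 2 * k) ≡ + 2 * c * k
        reorder = solve-∀
      form-f : form M f f ≡ + 4 * c * (c * x v - t * s v w)
      form-f = trans (form-sq M M-sym (+ 2 * c) (- t) (M v) (meet v w))
        (trans (cong₂ (λ y z → + 2 * c * (+ 2 * c) * x v + + 2 * (+ 2 * c * - t) * y + - t * - t * z)
                 (form-sym M M-sym (M v) (meet v w)) (meet-independent vw))
               (collect c t (x v) (s v w)))
        where collect : ∀ c t x s → + 2 * c * (+ 2 * c) * x + + 2 *
                (+ 2 * c * - t) * s + - t * - t * 0ℤ ≡ + 4 * c * (c * x - t * s)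
              collect = solve-∀
      small : + 9 * form M f f ≤ + 2 * c * (+ 2 * c) * (N * N)
      small = subst (λ z → + 9 * z ≤ + 2 * c * (+ 2 * c) * (N * N)) (sym form-f)
        (0≤i-j⇒j≤i (0≤-resp (expand c (c * x v - t * s v w) N)
          (0≤* (0≤* {+ 4} (+≤+ ℕ.z≤n) (<⇒≤ 0<c)) (i≤j⇒0≤j-i good))))
        where expand : ∀ c y N → + 4 * c * (c * (N * N) - + 9 * y) ≡ + 2 * c * (+ 2 * c) * (N * N) - + 9 * (+ 4 * c * y)
              expand = solve-∀

    -- Summing the failed tests over the neighbours of `u` turns codegrees into `x u` and `s` into
    -- `H₂ u`. Cauchy-Schwarz then replaces `H₂ u` by x² / d, and dividing by `x u` leaves the
    -- hypothesis `fail` of `Dense`.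
    dense-exists : N < + 2 * d → ¬ (∃ λ v → ∃ (DenseGood v)) → ⊥
    dense-exists N<2d none = all-brackets-pos⇒⊥ λ u →
      let open Dense N d (x u) 0<N 0<d N<2d (x-nonneg u) (fails u)
      in bracket-pos 0<d u x-pos κ-nonneg quad-pos
      where
      t : ℤ
      t = + 2 * d - N
      0<t : 0ℤ < t
      0<t = <⇒0<- N<2d
      0<d : 0ℤ < d
      0<d = 0<-cancel (+ 2) (+≤+ ℕ.z≤n) (<-trans 0<N N<2d)
      deficit : Fin n → Fin n → ℤ
      -- Over the integers a failed test fails by at least 1. Recording that unit leaves a surplus
      -- of `d` after summation, which keeps the inequality strict and rules out x = 0.
      deficit u w = + 9 * (codeg u w * x u - t * s u w) - codeg u w * (N * N) - 1ℤ
      deficit-nonneg : ∀ u w → 0ℤ ≤ M u w * deficit u w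
      deficit-nonneg u w with M u w in uw | M-bit u w
      ... | _ | bit0 = ≤-refl
      ... | _ | bit1 = 0≤-resp (shift (+ 9 * (codeg u w * x u - t * s u w)) (codeg u w * (N * N)))
            (i≤j⇒0≤j-i (i<j⇒suc[i]≤j (≰⇒> λ ≤ → none (u , w , uw , ≤))))
        where shift : ∀ a b → a - (1ℤ + b) ≡ 1ℤ * (a - b - 1ℤ)
              shift = solve-∀
      sum-s : ∀ u → (sum λ w → M u w * s u w) ≡ H₂ u
      sum-s u = trans (sum-cong λ w → cong (M u w *_) (sum-cong λ z → *-assoc (M w z) (M u z) (codeg u z)))
        (trans (form-sym M M-sym (M u) (Ph u)) (form-Ph-M u))
      total : ∀ u → 0ℤ ≤ + 9 * (x u * x u - t * H₂ u) - x u * (N * N) - d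
      total u = 0≤-resp (trans (sum-cong λ w → spread (M u w) (codeg u w) (x u) t (s u w) N)
          (trans (sum-lin₃ (+ 9 * x u - N * N) (- (+ 9 * t)) -1ℤ _ _ (M u))
          (trans (cong₂ (λ y z → (+ 9 * x u - N * N) * x u + - (+ 9 * t) * y + -1ℤ * z) (sum-s u) (M-reg u))
          (collect (x u) t (H₂ u) N d)))) (sum-nonneg _ (deficit-nonneg u))
        where
        spread : ∀ m c x t s N → m * (+ 9 * (c * x - t * s) - c * (N * N) - 1ℤ) ≡ (+ 9 * x - N * N) * (m * c) + -
          (+ 9 * t) * (m * s) + -1ℤ * m
        spread = solve-∀
        collect : ∀ x t h N d → (+ 9 * x - N * N) * x + - (+ 9 * t) * h + -1ℤ * d ≡ + 9 * (x * x - t * h) - x *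
          (N * N) - d
        collect = solve-∀
      fails : ∀ u → d * (N * N) < + 9 * x u * (N - d)
      fails u = 0<-⇒< (0<-cancel (x u) (x-nonneg u) (subst (0ℤ <_) (collect N d (x u) (H₂ u))
        (+-mono-≤-< (0≤+ (0≤* (<⇒≤ 0<d) (total u)) (0≤* (0≤* {+ 9} (+≤+ ℕ.z≤n) (<⇒≤ 0<t)) (cauchy-schwarz 0<d u)))
          (0<* 0<d 0<d))))
        where collect : ∀ N d x h → let t = + 2 * d - N in
                        d * (+ 9 * (x * x - t * h) - x * (N * N) - d) + + 9 * t * (d * h - x * x) + d * d ≡ x *
                          (+ 9 * x * (N - d) - d * (N * N))
              collect = solve-∀

    sparse-good? : Dec (∃ SparseGood)
    sparse-good? = any? λ v → + 9 * x v ≤? + 4 * (N * N) - + 17 * (N * d) + + 22 * (d * d)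

    dense-good? : Dec (∃ λ v → ∃ (DenseGood v))
    dense-good? = any? λ v → any? λ w → (M v w ≟ 1ℤ) ×-dec
      (+ 9 * (codeg v w * x v - (+ 2 * d - N) * s v w) ≤? codeg v w * (N * N))

    sparse-or-dense-half : Half
    sparse-or-dense-half = [ (λ 2d≤N → sparse-round 2d≤N (decidable-stable sparse-good? sparse-exists))
                           , (λ 2d≰N → let N<2d = ≰⇒> 2d≰N in dense-round N<2d
                             (decidable-stable dense-good? (dense-exists N<2d)))
                           ]′ (toSum (+ 2 * d ≤? N))

-- Lists and subsets as sums

ind-⇔ : {P Q : Set} (P? : Dec P) (Q? : Dec Q) → (P → Q) → (Q → P) → ind P? ≡ ind Q?
ind-⇔ (yes p) (yes q) f g = refl
ind-⇔ (yes p) (no ¬q) f g = contradiction (f p) ¬q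
ind-⇔ (no ¬p) (yes q) f g = contradiction (g q) ¬p
ind-⇔ (no ¬p) (no ¬q) f g = refl

ind-× : {P Q : Set} (P? : Dec P) (Q? : Dec Q) → ind (P? ×-dec Q?) ≡ ind P? * ind Q?
ind-× (yes p) (yes q) = refl
ind-× (yes p) (no ¬q) = refl
ind-× (no ¬p) (yes q) = refl
ind-× (no ¬p) (no ¬q) = refl

listSum : {A : Set} → (A → ℤ) → List A → ℤ
listSum g = List.foldr (λ x s → g x + s) 0ℤ

module _ {A : Set} where

  length-filter : ∀ {P : Pred A _} (P? : Decidable P) xs → + length (filter P? xs) ≡ listSum (ind ∘ P?) xs
  length-filter P? [] = refl
  length-filter P? (x ∷ xs) with P? x
  ... | yes _ = cong (λ s → 1ℤ + s) (length-filter P? xs)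
  ... | no  _ = trans (length-filter P? xs) (sym (+-identityˡ _))

  listSum-filter : ∀ {P : Pred A _} (P? : Decidable P) g xs → listSum g (filter P? xs) ≡ listSum
    (λ x → ind (P? x) * g x) xs
  listSum-filter P? g [] = refl
  listSum-filter P? g (x ∷ xs) with P? x
  ... | yes _ = cong₂ _+_ (sym (*-identityˡ (g x))) (listSum-filter P? g xs)
  ... | no  _ = trans (listSum-filter P? g xs) (sym (+-identityˡ _))

  listSum-++ : ∀ g (xs ys : List A) → listSum g (xs ++ ys) ≡ listSum g xs + listSum g ys
  listSum-++ g []       ys = sym (+-identityˡ _)
  listSum-++ g (x ∷ xs) ys = trans (cong (λ s → g x + s) (listSum-++ g xs ys)) (sym (+-assoc (g x) _ _))

  listSum-map : ∀ {B : Set} (g : A → ℤ) (f : B → A) xs → listSum g (List.map f xs) ≡ listSum (g ∘ f) xs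
  listSum-map g f []       = refl
  listSum-map g f (x ∷ xs) = cong (λ s → g (f x) + s) (listSum-map g f xs)

  listSum-tabulate : ∀ {n} (g : A → ℤ) (f : Fin n → A) → listSum g (List.tabulate f) ≡ sum (g ∘ f)
  listSum-tabulate {ℕ.zero}  g f = sym (sum-empty _)
  listSum-tabulate {ℕ.suc n} g f = trans (cong (λ s → g (f zero) + s) (listSum-tabulate g (f ∘ suc))) (sym (sum-suc _))

listSum-× : ∀ {A B : Set} (g : A × B → ℤ) xs ys → listSum g (cartesianProduct xs ys) ≡ listSum
  (λ x → listSum (λ y → g (x , y)) ys) xs
listSum-× g []       ys = refl
listSum-× g (x ∷ xs) ys = trans (listSum-++ g (List.map (x ,_) ys) _)
  (cong₂ _+_ (listSum-map g (x ,_) ys) (listSum-× g xs ys))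

listSum-pairs : ∀ {n} (g : Fin n × Fin n → ℤ) → listSum g
  (cartesianProduct (allFin n) (allFin n)) ≡ sum λ i → sum λ j → g (i , j)
listSum-pairs {n} g = trans (listSum-× g (allFin n) (allFin n))
  (trans (listSum-tabulate _ id) (sum-cong λ i → listSum-tabulate _ id))

card-ind : ∀ {n} (p : Subset n) → + ∣ p ∣ ≡ sum λ i → ind (i ∈? p)
card-ind [] = sym (sum-empty _)
card-ind (s ∷ p) = trans (head s)
  (sym (trans (sum-suc _)
  (cong (λ z → ind (zero ∈? (s ∷ p)) + z) (sum-cong λ i → ind-⇔ (suc i ∈? (s ∷ p)) (i ∈? p) drop-there there))))
  where
  head : ∀ s → + ∣ s ∷ p ∣ ≡ ind (zero ∈? (s ∷ p)) + sum λ i → ind (i ∈? p)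
  head inside  = cong (λ z → 1ℤ + z) (card-ind p)
  head outside = trans (card-ind p) (sym (+-identityˡ _))

fromBits : ∀ {n} → (Fin n → ℤ) → Subset n
fromBits χ = tabulate λ i → does (χ i ≟ 1ℤ)

ind-fromBits : ∀ {n} (χ : Fin n → ℤ) → (∀ i → Bit (χ i)) → ∀ i → ind (i ∈? fromBits χ) ≡ χ i
ind-fromBits χ χ-bit i = trans (ind-⇔ (i ∈? fromBits χ) (χ i ≟ 1ℤ) to from) (ind-bit≡ (χ-bit i))
  where
  to : i ∈ fromBits χ → χ i ≡ 1ℤ
  to i∈ with χ i ≟ 1ℤ | trans (sym (lookup∘tabulate (λ j → does (χ j ≟ 1ℤ)) i)) ([]=⇒lookup i∈)
  ... | yes χ≡1 | _ = χ≡1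
  ... | no  _   | ()
  from : χ i ≡ 1ℤ → i ∈ fromBits χ
  from χ≡1 = lookup⇒[]= i _ (trans (lookup∘tabulate (λ j → does (χ j ≟ 1ℤ)) i) (cong (λ z → does (z ≟ 1ℤ)) χ≡1))
  ind-bit≡ : ∀ {b} → Bit b → ind (b ≟ 1ℤ) ≡ b
  ind-bit≡ bit0 = refl
  ind-bit≡ bit1 = refl

ind-∁ : ∀ {n} (p : Subset n) i → ind (i ∈? ∁ p) ≡ 1ℤ * 1ℤ + -1ℤ * ind (i ∈? p)
ind-∁ p i with i ∈? ∁ p | i ∈? p
... | yes i∈∁ | yes i∈p = contradiction i∈p (x∈∁p⇒x∉p i∈∁)
... | yes _   | no  _   = refl
... | no  _   | yes _   = refl
... | no i∉∁  | no i∉p  = contradiction (x∉p⇒x∈∁p i∉p) i∉∁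

-- From graphs to adjacency matrices

module Adjacency {n} (G : Graph n) where
  open Graph G renaming (sym to ~-sym)

  adj : Fin n → Fin n → ℤ
  adj i j = ind (i ~? j)

  adj-bit : ∀ i j → Bit (adj i j)
  adj-bit i j = ind-bit (i ~? j)

  adj-sym : ∀ i j → adj i j ≡ adj j i
  adj-sym i j = ind-⇔ (i ~? j) (j ~? i) ~-sym ~-sym

  adj-diag : ∀ i → adj i i ≡ 0ℤ
  adj-diag i with i ~? i
  ... | yes i~i = contradiction i~i (irrefl refl)
  ... | no  _   = refl

  adj-degree : ∀ v → sum (adj v) ≡ + degree v
  adj-degree v = sym (trans (length-filter (v ~?_) (allFin n)) (listSum-tabulate (λ j → adj v j) id))

  adj-free : K₄-Free G → ∀ i j k l → adj i j ≡ 1ℤ → adj i k ≡ 1ℤ → adj i l ≡ 1ℤ →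
             adj j k ≡ 1ℤ → adj j l ≡ 1ℤ → adj k l ≡ 1ℤ → ⊥
  adj-free free i j k l ij ik il jk jl kl = free (f , injective , λ {a} {b} → edge a b)
    where
    f : Fin 4 → Fin n
    f 0F = i
    f 1F = j
    f 2F = k
    f 3F = l
    edge : ∀ a b → a ≢ b → f a ~ f b
    edge 0F 0F a≢b = contradiction refl a≢b
    edge 0F 1F _   = ind-1 (i ~? j) ij
    edge 0F 2F _   = ind-1 (i ~? k) ik
    edge 0F 3F _   = ind-1 (i ~? l) il
    edge 1F 0F _   = ~-sym (ind-1 (i ~? j) ij)
    edge 1F 1F a≢b = contradiction refl a≢b
    edge 1F 2F _   = ind-1 (j ~? k) jk
    edge 1F 3F _   = ind-1 (j ~? l) jl
    edge 2F 0F _   = ~-sym (ind-1 (i ~? k) ik)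
    edge 2F 1F _   = ~-sym (ind-1 (j ~? k) jk)
    edge 2F 2F a≢b = contradiction refl a≢b
    edge 2F 3F _   = ind-1 (k ~? l) kl
    edge 3F 0F _   = ~-sym (ind-1 (i ~? l) il)
    edge 3F 1F _   = ~-sym (ind-1 (j ~? l) jl)
    edge 3F 2F _   = ~-sym (ind-1 (k ~? l) kl)
    edge 3F 3F a≢b = contradiction refl a≢b
    injective : ∀ {a b} → f a ≡ f b → a ≡ b
    injective {a} {b} fa≡fb with a Fin.≟ b
    ... | yes a≡b = a≡b
    ... | no  a≢b = contradiction (edge a b a≢b) (irrefl fa≡fb)

  -- Off the diagonal exactly one of (i , j) and (j , i) is listed in `edges`, so each ordered pair
  -- is charged to its increasing orientation; the diagonal contributes nothing.
  form-edgesInside : ∀ S → let χ = λ i → ind (i ∈? S) in form adj χ χ ≡ + 2 * + length (edgesInside S)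
  form-edgesInside S = begin
    form adj χ χ                                                     ≡⟨ form-pairs adj χ χ ⟩
    (sum λ i → sum λ j → adj i j * (χ i * χ j))                      ≡⟨ sum-cong
      (λ i → trans (sum-cong (orient i)) (sum-lin₂ 1ℤ 1ℤ _ _)) ⟩
    (sum λ i → 1ℤ * sum (term i) + 1ℤ * sum (λ j → term j i))        ≡⟨ sum-lin₂ 1ℤ 1ℤ _ _ ⟩
    1ℤ * listed + 1ℤ *
      (sum λ i → sum λ j → term j i)                ≡⟨ cong (λ z → 1ℤ * listed + 1ℤ * z) (sum-swap (λ i j → term j i)) ⟩
    1ℤ * listed + 1ℤ * listed                                        ≡⟨ double listed ⟩
    + 2 * listed                                                     ≡⟨ cong (+ 2 *_) (sym count) ⟩
    + 2 * + length (edgesInside S)                                   ∎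
    where
    open ≡-Reasoning
    χ : Fin n → ℤ
    χ i = ind (i ∈? S)
    term : Fin n → Fin n → ℤ
    term i j = ind (i <? j) * adj i j * (χ i * χ j)
    listed : ℤ
    listed = sum λ i → sum (term i)
    double : ∀ a → 1ℤ * a + 1ℤ * a ≡ + 2 * a
    double = solve-∀
    count : + length (edgesInside S) ≡ listed
    count = trans (length-filter _ edges)
      (trans (listSum-filter _ _ (cartesianProduct (allFin n) (allFin n))) (trans (listSum-pairs _)
      (sum-cong λ i → sum-cong λ j → cong₂ _*_ (ind-× (i <? j) (i ~? j)) (ind-× (i ∈? S) (j ∈? S)))))
    orient : ∀ i j → adj i j * (χ i * χ j) ≡ 1ℤ * term i j + 1ℤ * term j i
    orient i j with Fin.<-cmp i j
    ... | tri< i<j _ j≮i = sym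
            (trans (cong₂ (λ a b → 1ℤ * (a * adj i j * (χ i * χ j)) + 1ℤ * (b * adj j i * (χ j * χ i)))
            (ind-yes (i <? j) i<j) (ind-no (j <? i) j≮i)) (forward (adj i j) (χ i * χ j) (adj j i) (χ j * χ i)))
      where
      forward : ∀ a b c d → 1ℤ * (1ℤ * a * b) + 1ℤ * (0ℤ * c * d) ≡ a * b
      forward = solve-∀
    ... | tri≈ _ refl _ = trans (cong (_* (χ i * χ i)) (adj-diag i))
            (sym (trans
            (cong (λ a → 1ℤ * (ind (i <? i) * a * (χ i * χ i)) + 1ℤ * (ind (i <? i) * a * (χ i * χ i)))
            (adj-diag i)) (loop (ind (i <? i)) (χ i * χ i))))
      where
      loop : ∀ a b → 1ℤ * (a * 0ℤ * b) + 1ℤ * (a * 0ℤ * b) ≡ 0ℤ * b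
      loop = solve-∀
    ... | tri> i≮j _ j<i = sym
            (trans (cong₂ (λ a b → 1ℤ * (a * adj i j * (χ i * χ j)) + 1ℤ * (b * adj j i * (χ j * χ i)))
            (ind-no (i <? j) i≮j) (ind-yes (j <? i) j<i))
        (trans (backward (adj i j) (χ i * χ j) (adj j i) (χ j * χ i)) (cong₂ _*_ (adj-sym j i) (*-comm (χ j) (χ i)))))
      where
      backward : ∀ a b c d → 1ℤ * (0ℤ * a * b) + 1ℤ * (1ℤ * c * d) ≡ c * d
      backward = solve-∀

corollary1p4 : (n : ℕ) → 2 ∣ n → (G : Graph n) → Graph.Regular G → K₄-Free G →
    Σ[ A ∈ Subset n ] Σ[ B ∈ Subset n ]
    (Partition A B
    × ∣ A ∣ ≡ n / 2
    × ∣ B ∣ ≡ n / 2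
    × 9 ℕ.* (length (Graph.edgesInside G A) ℕ.+ length (Graph.edgesInside G B)) ℕ.≤ n ℕ.^ 2)
-- The empty graph is separate because rounding needs a vertex to start from.
corollary1p4 ℕ.zero _ G _ _ = [] , [] , (refl , refl) , refl , refl , ℕ.z≤n
corollary1p4 n@(ℕ.suc _) (divides q n≡q*2) G (d , regular) free = A , B ,
  (p∪∁p≡⊤ A , ∩-inverseʳ A) , trans ∣A∣≡q q≡n/2 , trans ∣B∣≡q q≡n/2 , bound
  where
  open Adjacency G
  reg : ∀ i → sum (adj i) ≡ + d
  reg i = trans (adj-degree i) (cong +_ (regular i))
  module R = Regular adj adj-bit adj-sym adj-diag (adj-free free) (+ d) reg
  n≡2q : + n ≡ + 2 * + q
  n≡2q = trans (cong +_ (trans n≡q*2 (ℕ.*-comm q 2))) (pos-* 2 q)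
  halved : R.Half zero (+ q) n≡2q
  halved = R.sparse-or-dense-half zero (+ q) n≡2q
  χ : Fin n → ℤ
  χ = proj₁ halved
  A B : Subset n
  A = fromBits χ
  B = ∁ A
  χ≡A : ∀ i → ind (i ∈? A) ≡ χ i
  χ≡A = ind-fromBits χ (proj₁ (proj₂ halved))
  ∣A∣≡q : ∣ A ∣ ≡ q
  ∣A∣≡q = +-injective (trans (card-ind A) (trans (sum-cong χ≡A) (proj₁ (proj₂ (proj₂ halved)))))
  ∣B∣≡q : ∣ B ∣ ≡ q
  ∣B∣≡q = trans (∣∁p∣≡n∸∣p∣ A)
    (trans (cong₂ ℕ._∸_ (trans n≡q*2 (trans (ℕ.*-comm q 2) (cong (q ℕ.+_) (ℕ.+-identityʳ q)))) ∣A∣≡q) (ℕ.m+n∸m≡n q q))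
  q≡n/2 : q ≡ n / 2
  q≡n/2 = sym (trans (cong (_/ 2) n≡q*2) (m*n/n≡m q 2))
  χA χB : Fin n → ℤ
  χA i = ind (i ∈? A)
  χB i = ind (i ∈? B)
  formA≤ : + 9 * form adj χA χA ≤ + n * + n
  formA≤ = subst (λ z → + 9 * z ≤ + n * + n) (sym (form-cong adj χ≡A χ≡A)) (proj₂ (proj₂ (proj₂ halved)))
  formB≡formA : form adj χB χB ≡ form adj χA χA
  -- Expanding ⟨1 - χ , 1 - χ⟩ gives d n - 2 d q + ⟨χ , χ⟩, and n = 2q cancels the first two terms.
  formB≡formA = trans (form-cong adj (ind-∁ A) (ind-∁ A)) (trans (form-sq adj adj-sym 1ℤ -1ℤ (λ _ → 1ℤ) χA)
    (trans (cong₂ (λ y z → 1ℤ * 1ℤ * y + + 2 * (1ℤ * -1ℤ) * z + -1ℤ * -1ℤ * form adj χA χA)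
        (trans (R.form-1 (λ _ → 1ℤ)) (cong (+ d *_) (trans (sum-const n 1ℤ) (cong (_* 1ℤ) n≡2q))))
        (trans (form-sym adj adj-sym (λ _ → 1ℤ) χA)
          (trans (R.form-1 χA) (cong (+ d *_) (trans (sym (card-ind A)) (cong +_ ∣A∣≡q))))))
      (cancel (+ d) (+ q) (form adj χA χA))))
    where cancel : ∀ d q x → 1ℤ * 1ℤ * (d * (+ 2 * q * 1ℤ)) + + 2 * (1ℤ * -1ℤ) * (d * q) + -1ℤ * -1ℤ * x ≡ x
          cancel = solve-∀
  a b : ℕ
  a = length (Graph.edgesInside G A)
  b = length (Graph.edgesInside G B)
  bound : 9 ℕ.* (a ℕ.+ b) ℕ.≤ n ℕ.^ 2
  bound = drop‿+≤+
    (subst₂ _≤_ (trans (cong (+ 9 *_) (sym (pos-+ a b))) (sym (pos-* 9 (a ℕ.+ b))))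
    (trans (sym (pos-* n n)) (cong +_ (cong (n ℕ.*_) (sym (ℕ.*-identityʳ n)))))
    (0≤i-j⇒j≤i (0≤-cancel (+ 2) (+<+ (ℕ.s≤s ℕ.z≤n))
      (0≤-resp (trans
      (cong₂ (λ y z → (+ n * + n - + 9 * y) + (+ n * + n - + 9 * z)) (form-edgesInside A)
      (trans (sym formB≡formA) (form-edgesInside B)))
      (collect (+ n) (+ a) (+ b))) (0≤+ (i≤j⇒0≤j-i formA≤) (i≤j⇒0≤j-i formA≤))))))
    where collect : ∀ n a b → (n * n - + 9 * (+ 2 * a)) + (n * n - + 9 * (+ 2 * b)) ≡ + 2 * (n * n - + 9 * (a + b))
          collect = solve-∀
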